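{- Let $G$ be a finite simple partial $2$-tree with maximum degree at most $4$, let $V'$ be the set of vertices of degree $2$ in $G$, and let $\mathcal{S}=\{S_1,\dots,S_m\}$ be any collection of pairwise disjoint subsets of $V'$, each of size $2$. Then $G$ has a $2$-linear coloring satisfying $\mathcal{S}$, i.e. a $2$-linear coloring in which, for each $i\in\{1,\dots,m\}$, at most one of the two vertices of $S_i$ is monochromatic.
   Context: A partial $2$-tree is a graph admitting a tree decomposition of width at most $2$ (treewidth at most $2$). A linear forest is a forest each of whose components is a path. A $2$-linear coloring of $G$ is a map $c:E(G)\to\{1,2\}$ such that each color class forms a linear forest. Given a $2$-linear coloring of $G$, a vertex is called monochromatic if it has degree exactly $2$ in $G$ and both edges incident with it receive the same color. -}

module Defs where

open import Data.Nat using (ℕ; zero; suc; _+_; _≤_)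
open import Data.Fin using (Fin; zero; suc)
open import Data.Bool using (Bool; true; false; _∧_)
open import Data.Bool.Properties renaming (_≟_ to _≟ᵇ_)
open import Data.List using (List; []; _∷_; length; _∷ʳ_)
open import Data.List.Relation.Unary.Unique.Propositional using (Unique)
open import Data.List.Relation.Unary.Linked using (Linked)
open import Data.Product using (Σ; ∃; ∃-syntax; _×_; _,_)
open import Relation.Binary.PropositionalEquality using (_≡_; _≢_)
open import Relation.Nullary using (¬_; does)
open import Data.Unit using (⊤; tt)

b2n : Bool → ℕ
b2n true  = 1
b2n false = 0

countTrue : ∀ {n} → (Fin n → Bool) → ℕ
countTrue {zero}  f = 0
countTrue {suc n} f = b2n (f zero) + countTrue (λ i → f (suc i))

record Graph : Set where
  field
    n     : ℕ
    adj   : Fin n → Fin n → Bool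
    sym   : ∀ u v → adj u v ≡ adj v u
    irrefl : ∀ v → adj v v ≡ false
open Graph public

Adj : (G : Graph) → Fin (n G) → Fin (n G) → Set
Adj G u v = adj G u v ≡ true

degree : (G : Graph) → Fin (n G) → ℕ
degree G v = countTrue (adj G v)

data Walk {N : ℕ} (R : Fin N → Fin N → Set) (P : Fin N → Set) : Fin N → Fin N → Set where
  here : ∀ {u} → P u → Walk R P u u
  step : ∀ {u w v} → P u → R u w → Walk R P w v → Walk R P u v

Cycle : {N : ℕ} → (Fin N → Fin N → Set) → Set
Cycle {N} R = Σ (Fin N) λ x → Σ (List (Fin N)) λ ys →
  (2 ≤ length ys) × Unique (x ∷ ys) × Linked R ((x ∷ ys) ∷ʳ x)

Acyclic : {N : ℕ} → (Fin N → Fin N → Set) → Set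
Acyclic R = ¬ Cycle R

IsTree : Graph → Set
IsTree T = (∀ i j → Walk (Adj T) (λ _ → ⊤) i j) × Acyclic (Adj T)

record TreeDecomposition (G : Graph) (w : ℕ) : Set where
  field
    T        : Graph
    isTree   : IsTree T
    bag      : Fin (n T) → Fin (n G) → Bool
    bagSize  : ∀ i → countTrue (bag i) ≤ suc w
    covV     : ∀ v → ∃[ i ] bag i v ≡ true
    covE     : ∀ u v → Adj G u v → ∃[ i ] (bag i u ≡ true × bag i v ≡ true)
    conn     : ∀ v i j → bag i v ≡ true → bag j v ≡ true →
               Walk (Adj T) (λ k → bag k v ≡ true) i j

Partial2Tree : Graph → Set
Partial2Tree G = TreeDecomposition G 2

-- Edge colorings with colors in Bool (representing {1,2}); only values on
-- adjacent pairs matter, and they must be symmetric (edges are unordered).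
EdgeColoring : Graph → Set
EdgeColoring G = Σ (Fin (n G) → Fin (n G) → Bool) λ c →
  ∀ u v → Adj G u v → c u v ≡ c v u

ColorAdj : (G : Graph) → EdgeColoring G → Bool → Fin (n G) → Fin (n G) → Set
ColorAdj G (c , _) k u v = Adj G u v × c u v ≡ k

colorDegree : (G : Graph) → EdgeColoring G → Bool → Fin (n G) → ℕ
colorDegree G (c , _) k v = countTrue (λ w → adj G v w ∧ does (c v w ≟ᵇ k))

-- Linear forest: a forest (acyclic) all of whose vertices have degree ≤ 2
-- (equivalently, every component is a path).
IsLinearForestColor : (G : Graph) → EdgeColoring G → Bool → Set
IsLinearForestColor G c k =
  Acyclic (ColorAdj G c k) × (∀ v → colorDegree G c k v ≤ 2)

Is2LinearColoring : (G : Graph) → EdgeColoring G → Set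
Is2LinearColoring G c = ∀ k → IsLinearForestColor G c k

Monochromatic : (G : Graph) → EdgeColoring G → Fin (n G) → Set
Monochromatic G (c , _) v =
  degree G v ≡ 2 × (∀ w w′ → Adj G v w → Adj G v w′ → c v w ≡ c v w′)

{-# OPTIONS --safe #-}
module Submission where

-- Induction over the induced subgraphs of G, for an arbitrary involution σ in place of 𝒮: no v ≠ σ v may have
-- v and σ v both monochromatic (a vertex that does not have exactly two edges never is). Suppressing the vertices
-- of degree 2 leaves a graph of treewidth ≤ 2, so a vertex w that comes first in an elimination order among those
-- of degree ≥ 3 sees at most two vertices. Hence there is a vertex of degree ≤ 1, two adjacent vertices of degree
-- 2, two vertices of degree 2 with the same neighbours, or a vertex w with one or two triangles w p u, deg u = 2,
-- and at most one further edge. In each case deleting the vertices of degree ≤ 2 involved (and w in the last one)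
-- and re-pairing the vertices that are left yields a colouring that extends: the new pairs exclude exactly the
-- colourings for which a deleted vertex and its partner would both be monochromatic.

open import Defs
open import Data.Bool using (Bool; true; false; _∧_; not; if_then_else_)
open import Data.Bool.Properties using (∧-identityʳ; not-injective; not-involutive) renaming (_≟_ to _≟ᵇ_)
open import Data.Empty using (⊥; ⊥-elim)
open import Data.Fin using (Fin; zero; suc; _≟_)
open import Data.Fin.Properties using (any?; all?)
open import Data.List using (List; []; _∷_; length; _∷ʳ_)
open import Data.List.Membership.DecPropositional using () renaming (_∈?_ to member?)
open import Data.List.Membership.Propositional using (_∈_)
open import Data.List.Relation.Unary.All using (All; []; _∷_)
import Data.List.Relation.Unary.All as All
open import Data.List.Relation.Unary.All.Properties using (¬Any⇒All¬)
open import Data.List.Relation.Unary.AllPairs using ([]; _∷_)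
open import Data.List.Relation.Unary.Any using (here; there)
open import Data.List.Relation.Unary.Linked using (Linked; []; [-]; _∷_)
open import Data.List.Relation.Unary.Unique.Propositional using (Unique)
open import Data.Nat using (ℕ; zero; suc; _+_; _≤_; _<_; z≤n; s≤s)
open import Data.Nat.Properties using (≤-refl; ≤-trans; <⇒≤; <-cmp; <-irrefl; ≤-<-trans; ≤-total; ≤-pred; suc-injective; +-suc; +-mono-≤)
open import Data.Product using (Σ; ∃; ∃-syntax; _×_; _,_; proj₁; proj₂)
open import Data.Sum using (_⊎_; inj₁; inj₂; [_,_])
import Data.Sum as Sum
open import Data.Unit using (⊤; tt)
open import Function using (_∘_; id)
open import Relation.Binary using (tri<; tri≈; tri>)
open import Relation.Binary.PropositionalEquality using (_≡_; _≢_; refl; trans; cong; cong₂; subst; ≢-sym) renaming (sym to ≡-sym)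
open import Relation.Nullary using (¬_; Dec; yes; no; does)
open import Relation.Nullary.Decidable using (_×-dec_; _⊎-dec_; _→-dec_; ¬?; map′; dec-true; dec-false)

-- Deletion turns vertices of degree 3 and 4 into vertices of degree 2, so pairs must be allowed on
-- all vertices. What makes pairs the right constraint is a dichotomy at a vertex that has lost two
-- of its four edges: unless it is monochromatic, each colour can be used once more at it; if it is,
-- the missing colour must be used for both new edges. Whether a colouring extends thus depends only
-- on which of a few vertices are monochromatic, and a pair excludes one bad combination. Each
-- vertex has only one partner, so re-pairing breaks older pairs, but only pairs containing a
-- deleted vertex or a surviving neighbour of one. The new edges are coloured so that these
-- neighbours are never monochromatic, hence their pairs are not missed. The components of the
-- colour classes need not be remembered: a new path of one colour through an inserted vertex always
-- stops there or at a neighbour, so it closes no cycle. Induced subgraphs are predicates `W` on a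
-- fixed vertex set, so one elimination order of `G` serves them all, and the suppression of
-- vertices of degree 2 is never carried out on graphs.

-- Counting by deletion.

infixl 6 _∖_
_∖_ : {A : Set} → (A → Set) → A → (A → Set)
(P ∖ x) y = P y × y ≢ x

-- Instantiating the bound at an element gives the bound for the set without it. The same step
-- therefore yields the drop of a degree when a neighbour is deleted and the decrease of the
-- induction measure, and shrinking `P` needs no decidability.
AtMost : {A : Set} → ℕ → (A → Set) → Set
AtMost zero    P = ∀ x → ¬ P x
AtMost (suc n) P = ∀ x → P x → AtMost n (P ∖ x)

AtLeast : {A : Set} → ℕ → (A → Set) → Set
AtLeast zero    P = ⊤
AtLeast (suc n) P = ∃[ x ] P x × AtLeast n (P ∖ x)

atMost-⊆ : {A : Set} (n : ℕ) {P Q : A → Set} → (∀ {y} → P y → Q y) → AtMost n Q → AtMost n P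
atMost-⊆ zero    P⊆Q h x px = h x (P⊆Q px)
atMost-⊆ (suc n) P⊆Q h x px = atMost-⊆ n (λ (py , y≢x) → P⊆Q py , y≢x) (h x (P⊆Q px))

atLeast-⊆ : {A : Set} (n : ℕ) {P Q : A → Set} → (∀ {y} → P y → Q y) → AtLeast n P → AtLeast n Q
atLeast-⊆ zero    P⊆Q _            = tt
atLeast-⊆ (suc n) P⊆Q (x , px , h) = x , P⊆Q px , atLeast-⊆ n (λ (py , y≢x) → P⊆Q py , y≢x) h

atMost-suc : {A : Set} (n : ℕ) {P : A → Set} → AtMost n P → AtMost (suc n) P
atMost-suc n h x px = atMost-⊆ n proj₁ h

atMost-insert : {N : ℕ} (n : ℕ) {P : Fin N → Set} (x : Fin N) → AtMost n (P ∖ x) → AtMost (suc n) P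
atMost-insert n x h y py with y ≟ x
... | yes refl = h
atMost-insert zero x h y py | no y≢x = ⊥-elim (h y (py , y≢x))
atMost-insert (suc n) x h y py | no y≢x =
  atMost-insert n x (atMost-⊆ n (λ ((pz , z≢y) , z≢x) → (pz , z≢x) , z≢y) (h y (py , y≢x)))

remove? : {N : ℕ} {P : Fin N → Set} → (∀ y → Dec (P y)) → (x : Fin N) → ∀ y → Dec ((P ∖ x) y)
remove? P? x y = P? y ×-dec ¬? (y ≟ x)

atLeast⊎atMost : {N : ℕ} {P : Fin N → Set} → (∀ x → Dec (P x)) → (n : ℕ) →
                 AtLeast (suc n) P ⊎ AtMost n P
atLeast⊎atMost P? n with any? P?
atLeast⊎atMost P? zero    | yes (x , px) = inj₁ (x , px , tt)
atLeast⊎atMost P? zero    | no ∄ = inj₂ λ x px → ∄ (x , px)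
atLeast⊎atMost P? (suc n) | no ∄ = inj₂ λ x px → ⊥-elim (∄ (x , px))
atLeast⊎atMost P? (suc n) | yes (x , px) with atLeast⊎atMost (remove? P? x) n
... | inj₁ h = inj₁ (x , px , h)
... | inj₂ h = inj₂ (atMost-insert n x h)

atLeast-atMost-⊥ : {A : Set} (n : ℕ) {P : A → Set} → AtLeast (suc n) P → AtMost n P → ⊥
atLeast-atMost-⊥ zero    (x , px , _) h = h x px
atLeast-atMost-⊥ (suc n) (x , px , r) h = atLeast-atMost-⊥ n r (h x px)

atMost? : {N : ℕ} {P : Fin N → Set} → (∀ x → Dec (P x)) → (n : ℕ) → Dec (AtMost n P)
atMost? P? n with atLeast⊎atMost P? n
... | inj₁ many = no (atLeast-atMost-⊥ n many)
... | inj₂ few  = yes few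

pair : {A : Set} {P : A → Set} {a b : A} → a ≢ b → P a → P b → AtLeast 2 P
pair a≢b pa pb = _ , pa , _ , (pb , λ b≡a → a≢b (≡-sym b≡a)) , tt

atMost2-cases : {N : ℕ} {P : Fin N → Set} {a b : Fin N} → AtMost 2 P → a ≢ b → P a → P b →
                ∀ y → P y → y ≡ a ⊎ y ≡ b
atMost2-cases {a = a} {b} h a≢b pa pb y py with y ≟ a | y ≟ b
... | yes y≡a | _       = inj₁ y≡a
... | no _    | yes y≡b = inj₂ y≡b
... | no y≢a  | no y≢b  = ⊥-elim (h a pa b (pb , a≢b ∘ ≡-sym) y ((py , y≢a) , y≢b))

-- Comparison with the Boolean count.

infixl 6 _without_
_without_ : {N : ℕ} → (Fin N → Bool) → Fin N → Fin N → Bool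
(f without x) y = f y ∧ not (does (y ≟ x))

countTrue-cong : {N : ℕ} {f g : Fin N → Bool} → (∀ i → f i ≡ g i) → countTrue f ≡ countTrue g
countTrue-cong {zero}  f≗g = refl
countTrue-cong {suc N} f≗g = cong₂ _+_ (cong b2n (f≗g zero)) (countTrue-cong (f≗g ∘ suc))

countTrue-without : {N : ℕ} (f : Fin N → Bool) (x : Fin N) → f x ≡ true →
                    countTrue f ≡ suc (countTrue (f without x))
countTrue-without f zero fx rewrite fx =
  cong suc (countTrue-cong λ i → ≡-sym (∧-identityʳ (f (suc i))))
countTrue-without f (suc x) fx
  rewrite countTrue-without (f ∘ suc) x fx | ∧-identityʳ (f zero) =
  +-suc (b2n (f zero)) _

countTrue-none : {N : ℕ} (f : Fin N → Bool) → (∀ x → f x ≢ true) → countTrue f ≡ 0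
countTrue-none {zero}  f none = refl
countTrue-none {suc N} f none with f zero in eq
... | true  = ⊥-elim (none zero eq)
... | false = countTrue-none (f ∘ suc) (none ∘ suc)

countTrue≤⇒atMost : {N : ℕ} (n : ℕ) (f : Fin N → Bool) → countTrue f ≤ n → AtMost n (λ x → f x ≡ true)
countTrue≤⇒atMost zero f h x fx rewrite countTrue-without f x fx with () ← h
countTrue≤⇒atMost (suc n) f h x fx rewrite countTrue-without f x fx =
  atMost-⊆ n keep (countTrue≤⇒atMost n (f without x) (≤-pred h))
  where
  keep : ∀ {y} → f y ≡ true × y ≢ x → (f without x) y ≡ true
  keep {y} (fy , y≢x) rewrite fy | dec-false (y ≟ x) y≢x = refl

atMost⇒countTrue≤ : {N : ℕ} (n : ℕ) (f : Fin N → Bool) → AtMost n (λ x → f x ≡ true) → countTrue f ≤ n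
atMost⇒countTrue≤ n f h with any? (λ x → f x ≟ᵇ true)
... | no ∄ rewrite countTrue-none f (λ x fx → ∄ (x , fx)) = z≤n
atMost⇒countTrue≤ zero    f h | yes (x , fx) = ⊥-elim (h x fx)
atMost⇒countTrue≤ (suc n) f h | yes (x , fx) rewrite countTrue-without f x fx =
  s≤s (atMost⇒countTrue≤ n (f without x) (atMost-⊆ n drop (h x fx)))
  where
  drop : ∀ {y} → (f without x) y ≡ true → f y ≡ true × y ≢ x
  drop {y} p with f y | y ≟ x
  drop {y} p  | true | no y≢x = refl , y≢x
  drop {y} () | true | yes _
  drop {y} () | false | _

countTrue≤N : {N : ℕ} (f : Fin N → Bool) → countTrue f ≤ N
countTrue≤N {zero}  f = z≤n
countTrue≤N {suc N} f = +-mono-≤ (b2n≤1 (f zero)) (countTrue≤N (f ∘ suc))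
  where
  b2n≤1 : ∀ b → b2n b ≤ 1
  b2n≤1 true  = ≤-refl
  b2n≤1 false = z≤n

atMost-N : {N : ℕ} (P : Fin N → Set) → AtMost N P
atMost-N {N} P = atMost-⊆ N (λ _ → refl) (countTrue≤⇒atMost N (λ _ → true) (countTrue≤N {N} (λ _ → true)))

-- Cycles, cores and leaves.

-- Acyclicity is carried through the induction in the form NoCore: a vertex with at most one neighbour lies in no
-- core, so it can be discarded without looking inside a list of vertices.
Core : {A : Set} → (A → A → Set) → (A → Set) → Set
Core R S = ∃ S × (∀ x → S x → AtLeast 2 (λ y → S y × R x y))

NoCore : {A : Set} → (A → A → Set) → Set₁
NoCore R = ∀ S → ¬ Core R S

-- This encodes a rooted forest: the one neighbour of larger `ord` is the parent, and injectivity
-- makes one end of every edge the lower one.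
Rank : {N : ℕ} → (Fin N → Fin N → Set) → (Fin N → Set) → (Fin N → ℕ) → Set
Rank R X ord = (∀ i j → X i → X j → ord i ≡ ord j → i ≡ j) ×
               (∀ i → X i → AtMost 1 (λ j → X j × R i j × ord i < ord j))

module _ {N : ℕ} {R : Fin N → Fin N → Set} (R-sym : ∀ {x y} → R x y → R y x) where

  -- The two neighbours are the predecessor and the successor on the path. On a cycle `a` and `e`
  -- are the same vertex, so these two could coincide only at a sole inner vertex, which the
  -- hypothesis on `cs ≡ []` excludes.
  inner-neighbours : {Q : Fin N → Set} (a b : Fin N) (cs : List (Fin N)) (e : Fin N) →
    Linked R (a ∷ b ∷ cs ∷ʳ e) → Q a → Q e → All Q (b ∷ cs) → Unique (a ∷ b ∷ cs) →
    (cs ≡ [] → a ≢ e) → All (e ≢_) (b ∷ cs) → All (λ z → AtLeast 2 (λ y → Q y × R z y)) (b ∷ cs)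
  inner-neighbours a b [] e (ab ∷ be ∷ _) qa qe _ _ a≢e _ =
    pair (a≢e refl) (qa , R-sym ab) (qe , be) ∷ []
  inner-neighbours a b (c ∷ cs) e (ab ∷ bc ∷ l) qa qe (qb ∷ qc ∷ qs) ((_ ∷ a≢c ∷ _) ∷ u) _ (e≢b ∷ e≢) =
    pair a≢c (qa , R-sym ab) (qc , bc) ∷
    inner-neighbours b c cs e (bc ∷ l) qb qe (qc ∷ qs) u (λ _ b≡e → e≢b (≡-sym b≡e)) e≢

  last-neighbour : (b c : Fin N) (cs : List (Fin N)) (e : Fin N) → Linked R (b ∷ c ∷ cs ∷ʳ e) →
                   ∃[ l ] l ∈ c ∷ cs × R l e
  last-neighbour b c []       e (_ ∷ ce ∷ _) = c , here refl , ce
  last-neighbour b c (d ∷ cs) e (_ ∷ l) with last-neighbour c d cs e l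
  ... | l , l∈ , le = l , there l∈ , le

  -- The vertices of a cycle form a core; the base point has the second and the last vertex of the
  -- list as its neighbours.
  noCore⇒acyclic : NoCore R → Acyclic R
  noCore⇒acyclic noCore (x , [] , () , _)
  noCore⇒acyclic noCore (x , _ ∷ [] , s≤s () , _)
  noCore⇒acyclic noCore (x , b ∷ c ∷ cs , _ , u@(x∉ ∷ (b∉ ∷ _)) , linked@(xb ∷ l)) =
    noCore (_∈ x ∷ b ∷ c ∷ cs) ((x , here refl) , λ z z∈ → All.lookup (atX ∷ others) z∈)
    where
    others = inner-neighbours {Q = _∈ x ∷ b ∷ c ∷ cs} x b (c ∷ cs) x linked (here refl) (here refl)
      (All.tabulate there) u (λ ()) x∉
    final = last-neighbour b c cs x l
    atX : AtLeast 2 (λ y → y ∈ x ∷ b ∷ c ∷ cs × R x y)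
    atX = pair (All.lookup b∉ (proj₁ (proj₂ final)))
      (there (here refl) , xb) (there (there (proj₁ (proj₂ final))) , R-sym (proj₂ (proj₂ final)))

  -- The path is cut off at `z`, from where the edge to `x` closes a cycle. The component quantified
  -- over `P` carries the distinctness from other vertices over to the shortened list.
  close-up : (a z : Fin N) (cs : List (Fin N)) (x : Fin N) → z ∈ cs → R z x →
    Unique cs → Linked R (a ∷ cs) →
    ∃[ ps ] 1 ≤ length ps × Unique ps × (∀ {P : Fin N → Set} → All P cs → All P ps) × Linked R (a ∷ ps ∷ʳ x)
  close-up a z (_ ∷ cs) x (here refl) zx _ (az ∷ _) =
    z ∷ [] , s≤s z≤n , [] ∷ [] , (λ { (p ∷ _) → p ∷ [] }) , az ∷ zx ∷ [-]
  close-up a z (c ∷ cs) x (there z∈) zx (c∉ ∷ u) (ac ∷ l) with close-up c z cs x z∈ zx u l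
  ... | ps , 1≤ , ups , sub , l′ =
    c ∷ ps , s≤s z≤n , sub c∉ ∷ ups , (λ { (p ∷ qs) → p ∷ sub qs }) , ac ∷ l′

  module _ (irr : ∀ {x} → ¬ R x x) (acyclic : Acyclic R) {X : Fin N → Set}
           (many : ∀ x → X x → AtLeast 2 (λ y → X y × R x y)) where

    -- The path grows at its front, avoiding the vertex `y` it came from, which is possible because
    -- every vertex has a second neighbour. Meeting the path again closes a cycle, so growth ends
    -- only when `k`, a bound on the vertices off the path, is used up.
    no-long-path : (k : ℕ) (x y : Fin N) (cs : List (Fin N)) → X x → Unique (x ∷ y ∷ cs) → Linked R (x ∷ y ∷ cs) →
                   AtMost k (λ z → ¬ z ∈ x ∷ y ∷ cs) → ⊥
    extend-path : (k : ℕ) (x y : Fin N) (cs : List (Fin N)) → Unique (x ∷ y ∷ cs) → Linked R (x ∷ y ∷ cs) →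
                   AtMost k (λ z → ¬ z ∈ x ∷ y ∷ cs) → (z : Fin N) → X z → R x z → z ≢ y → ⊥

    no-long-path k x y cs xX u l fuel with many x xX
    ... | z , (zX , xz) , z′ , ((z′X , xz′) , z′≢z) , _ with z ≟ y
    ... | no  z≢y  = extend-path k x y cs u l fuel z zX xz z≢y
    ... | yes refl = extend-path k x y cs u l fuel z′ z′X xz′ z′≢z

    extend-path k x y cs u l fuel z zX xz z≢y with member? _≟_ z (x ∷ y ∷ cs)
    ... | yes (here refl) = irr xz
    ... | yes (there (here z≡y)) = z≢y z≡y
    extend-path k x y cs ((x≢y ∷ x∉) ∷ (y∉ ∷ u)) (xy ∷ l) fuel z zX xz z≢y
      | yes (there (there z∈)) with close-up y z cs x z∈ (R-sym xz) u l
    ... | ps , 1≤ , ups , sub , l′ =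
      acyclic (x , y ∷ ps , s≤s 1≤ , (x≢y ∷ sub x∉) ∷ (sub y∉ ∷ ups) , xy ∷ l′)
    extend-path zero x y cs u l fuel z zX xz z≢y | no z∉ = fuel z z∉
    extend-path (suc k) x y cs u l fuel z zX xz z≢y | no z∉ =
      no-long-path k z x (y ∷ cs) zX (¬Any⇒All¬ _ z∉ ∷ u) (R-sym xz ∷ l)
        (atMost-⊆ k (λ w∉ → (λ w∈ → w∉ (there w∈)) , λ w≡z → w∉ (here w≡z)) (fuel z z∉))

    no-dense-set : ¬ ∃ X
    no-dense-set (x , xX) with many x xX
    ... | z , (zX , xz) , _ = no-long-path N z x [] zX
      (((λ { refl → irr xz }) ∷ []) ∷ [] ∷ []) (R-sym xz ∷ [-]) (atMost-N _)

  leaf : (∀ {x} → ¬ R x x) → Acyclic R → (∀ x y → Dec (R x y)) →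
         {X : Fin N → Set} → (∀ x → Dec (X x)) → ∃ X → ∃[ x ] X x × AtMost 1 (λ y → X y × R x y)
  leaf irr acyclic R? {X} X? nonempty
    with any? (λ x → X? x ×-dec atMost? (λ y → X? y ×-dec R? x y) 1)
  ... | yes l = l
  ... | no ∄  = ⊥-elim (no-dense-set irr acyclic dense nonempty)
    where
    dense : ∀ x → X x → AtLeast 2 (λ y → X y × R x y)
    dense x xX with atLeast⊎atMost (λ y → X? y ×-dec R? x y) 1
    ... | inj₁ many = many
    ... | inj₂ few  = ⊥-elim (∄ (x , xX , few))

  forest-rank : (∀ {x} → ¬ R x x) → Acyclic R → (∀ x y → Dec (R x y)) →
                (k : ℕ) {X : Fin N → Set} → (∀ x → Dec (X x)) → AtMost k X → ∃ (Rank R X)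
  forest-rank irr acyclic R? zero X? few =
    (λ _ → 0) , (λ i j xi → ⊥-elim (few i xi)) , λ i xi → ⊥-elim (few i xi)
  forest-rank irr acyclic R? (suc k) {X} X? few with any? X?
  ... | no ∄ = (λ _ → 0) , (λ i j xi → ⊥-elim (∄ (i , xi))) , λ i xi → ⊥-elim (∄ (i , xi))
  ... | yes nonempty with leaf irr acyclic R? X? nonempty
  ... | x , xX , xleaf with forest-rank irr acyclic R? k (remove? X? x) (few x xX)
  ... | ord , inj , up = ord′ , inj′ , up′
    where
    -- The removed leaf becomes the minimum: its neighbours all lie above it, and there is at most
    -- one of them.
    ord′ : Fin N → ℕ
    ord′ i with i ≟ x
    ... | yes _ = 0
    ... | no  _ = suc (ord i)

    inj′ : ∀ i j → X i → X j → ord′ i ≡ ord′ j → i ≡ j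
    inj′ i j xi xj eq with i ≟ x | j ≟ x
    ... | yes i≡x | yes j≡x = trans i≡x (≡-sym j≡x)
    inj′ i j xi xj () | yes _ | no _
    inj′ i j xi xj () | no _ | yes _
    ... | no i≢x | no j≢x = inj i j (xi , i≢x) (xj , j≢x) (suc-injective eq)

    up′ : ∀ i → X i → AtMost 1 (λ j → X j × R i j × ord′ i < ord′ j)
    up′ i xi with i ≟ x
    ... | yes refl = atMost-⊆ 1 (λ (xj , ij , _) → xj , ij) xleaf
    ... | no i≢x = atMost-⊆ 1 later (up i (xi , i≢x))
      where
      later : ∀ {j} → X j × R i j × suc (ord i) < ord′ j → (X ∖ x) j × R i j × ord i < ord j
      later {j} (xj , ij , lt) with j ≟ x
      later {j} (xj , ij , ()) | yes _
      later {j} (xj , ij , s≤s lt) | no j≢x = (xj , j≢x) , ij , lt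

extremal : {N : ℕ} {_≼_ : Fin N → Fin N → Set} → (∀ {x} → x ≼ x) → (∀ {x y z} → x ≼ y → y ≼ z → x ≼ z) →
           (∀ x y → x ≼ y ⊎ y ≼ x) → (k : ℕ) {P : Fin N → Set} → (∀ x → Dec (P x)) → AtMost k P →
           ∃ P → ∃[ x ] P x × (∀ y → P y → x ≼ y)
extremal rfl tra tot zero P? few (x , px) = ⊥-elim (few x px)
extremal {_≼_ = _≼_} rfl tra tot (suc k) {P} P? few (x , px) with any? (remove? P? x)
... | no ∄ = x , px , least
  where
  least : ∀ y → P y → x ≼ y
  least y py with y ≟ x
  ... | yes refl = rfl
  ... | no y≢x = ⊥-elim (∄ (y , py , y≢x))
... | yes rest with extremal rfl tra tot k (remove? P? x) (few x px) rest
... | m , (pm , _) , m≼ with tot x m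
... | inj₁ x≼m = x , px , least
  where
  least : ∀ y → P y → x ≼ y
  least y py with y ≟ x
  ... | yes refl = rfl
  ... | no y≢x = tra x≼m (m≼ y (py , y≢x))
... | inj₂ m≼x = m , pm , least
  where
  least : ∀ y → P y → m ≼ y
  least y py with y ≟ x
  ... | yes refl = m≼x
  ... | no y≢x = m≼ y (py , y≢x)

-- An elimination order from the tree decomposition.

-- T is rooted by repeatedly removing leaves; v is ranked by the topmost bag that contains it, and that bag is Later v.

adj-sym : (H : Graph) {u v : Fin (n H)} → Adj H u v → Adj H v u
adj-sym H {u} {v} uv = trans (sym H v u) uv

adj-irr : (H : Graph) {v : Fin (n H)} → ¬ Adj H v v
adj-irr H {v} vv with () ← trans (≡-sym vv) (irrefl H v)

-- `Later` describes a chordal supergraph of `G`, in which `fill` makes the later neighbours of a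
-- vertex a clique. Ranks may tie, since several vertices can have the same topmost bag; hence the
-- weak inequalities.
record Elimination (G : Graph) : Set₁ where
  field
    rank     : Fin (n G) → ℕ
    Later    : Fin (n G) → Fin (n G) → Set
    few      : ∀ v → AtMost 2 (Later v ∖ v)
    edge     : ∀ {v y} → Adj G v y → rank v ≤ rank y → Later v y
    fill     : ∀ {u v y} → Later u v → Later u y → rank v ≤ rank y → Later v y

module _ (G : Graph) (D : Partial2Tree G) where
  open TreeDecomposition D

  private
    ranked : ∃ (Rank (Adj T) (λ _ → ⊤))
    ranked = forest-rank (adj-sym T) (adj-irr T) (proj₂ isTree) (λ x y → adj T x y ≟ᵇ true)
      (n T) (λ _ → yes tt) (atMost-N _)

    ord : Fin (n T) → ℕ
    ord = proj₁ ranked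

    data Chain (K : Fin (n T) → Set) : Fin (n T) → Fin (n T) → Set where
      done : ∀ {i} → K i → Chain K i i
      up   : ∀ {i j t} → K i → Adj T i j → ord i < ord j → Chain K j t → Chain K i t

    chain-start : ∀ {K i t} → Chain K i t → K i
    chain-start (done k)     = k
    chain-start (up k _ _ _) = k

    chain-rises : ∀ {K i t} → Chain K i t → ord i ≤ ord t
    chain-rises (done _)      = ≤-refl
    chain-rises (up _ _ lt c) = ≤-trans (<⇒≤ lt) (chain-rises c)

    up-unique : ∀ {i j k} → Adj T i j → ord i < ord j → Adj T i k → ord i < ord k → j ≡ k
    up-unique {i} {j} {k} ij i<j ik i<k with k ≟ j
    ... | yes k≡j = ≡-sym k≡j
    ... | no k≢j = ⊥-elim (proj₂ (proj₂ ranked) i tt j (tt , ij , i<j) k ((tt , ik , i<k) , k≢j))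

    -- If the walk starts by descending from `i` to `w`, the chain above `w` has to go through the
    -- only upper neighbour of `w`, which is `i`; dropping this detour leaves a chain from `i`.
    chain : ∀ {K i t} → Walk (Adj T) K i t → (∀ j → K j → ord j ≤ ord t) → Chain K i t
    chain (Walk.here k) top = done k
    chain {K} {i} (step {w = w} k iw walk) top with chain walk top | <-cmp (ord i) (ord w)
    ... | c | tri< i<w _ _ = up k iw i<w c
    ... | c | tri≈ _ i≈w _ with refl ← proj₁ (proj₂ ranked) i w tt tt i≈w = ⊥-elim (adj-irr T iw)
    ... | done _ | tri> _ _ w<i = ⊥-elim (<-irrefl refl (≤-<-trans (top i k) w<i))
    ... | up _ wj w<j c | tri> _ _ w<i with refl ← up-unique wj w<j (adj-sym T iw) w<i = c

    -- Upper neighbours are unique, so two ascending chains with the same start run together and the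
    -- longer one passes through the end of the shorter.
    chains-meet : ∀ {K K′ j t t′} → Chain K j t → Chain K′ j t′ → ord t ≤ ord t′ → K′ t
    chains-meet (done _) c′ _ = chain-start c′
    chains-meet (up _ _ lt c) (done _) le = ⊥-elim (<-irrefl refl (≤-<-trans (≤-trans (chain-rises c) le) lt))
    chains-meet (up _ ij i<j c) (up _ ik i<k c′) le with refl ← up-unique ij i<j ik i<k = chains-meet c c′ le

    topmost : ∀ v → ∃[ t ] bag t v ≡ true × (∀ j → bag j v ≡ true → ord j ≤ ord t)
    topmost v = extremal {_≼_ = λ i j → ord j ≤ ord i} ≤-refl (λ p q → ≤-trans q p)
      (λ i j → ≤-total (ord j) (ord i)) (n T) (λ i → bag i v ≟ᵇ true) (atMost-N _) (covV v)

    top : Fin (n G) → Fin (n T)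
    top v = proj₁ (topmost v)

    share : ∀ {v y j} → bag j v ≡ true → bag j y ≡ true → ord (top v) ≤ ord (top y) → bag (top v) y ≡ true
    share {v} {y} {j} jv jy le = chains-meet (to-top v jv) (to-top y jy) le
      where
      to-top : ∀ v → bag j v ≡ true → Chain (λ i → bag i v ≡ true) j (top v)
      to-top v jv = chain (conn v j (top v) jv (proj₁ (proj₂ (topmost v)))) (proj₂ (proj₂ (topmost v)))

  elimination : Elimination G
  elimination = record
    { rank  = λ v → ord (top v)
    ; Later = λ v y → bag (top v) y ≡ true
    -- A bag has at most three elements, and `v` is one of those in its own topmost bag.
    ; few   = λ v → countTrue≤⇒atMost 3 (bag (top v)) (bagSize (top v)) v (proj₁ (proj₂ (topmost v)))
    ; edge  = λ {v} {y} vy le → share (proj₁ (proj₂ (covE v y vy))) (proj₂ (proj₂ (covE v y vy))) le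
    ; fill  = λ {u} uv uy le → share {j = top u} uv uy le
    }

-- Involutions and their rewiring.

not-≢ : ∀ b → b ≢ not b
not-≢ true  ()
not-≢ false ()

record Involution (A : Set) : Set where
  field
    map        : A → A
    involutive : ∀ x → map (map x) ≡ x

  injective : ∀ {x y} → map x ≡ map y → x ≡ y
  injective {x} {y} eq = trans (≡-sym (involutive x)) (trans (cong map eq) (involutive y))

  flip : ∀ {x y} → map x ≡ y → x ≡ map y
  flip {x} refl = ≡-sym (involutive x)

open Involution

-- The former partners of a and b become fixed points.
module Rewire {N : ℕ} (σ : Involution (Fin N)) (a b : Fin N) where

  partner : Fin N → Fin N
  partner x with x ≟ a | x ≟ b | map σ x ≟ a | map σ x ≟ b
  ... | yes _ | _     | _     | _     = b
  ... | no _  | yes _ | _     | _     = a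
  ... | no _  | no _  | yes _ | _     = x
  ... | no _  | no _  | no _  | yes _ = x
  ... | no _  | no _  | no _  | no _  = map σ x

  partner-a : partner a ≡ b
  partner-a with a ≟ a
  ... | yes _ = refl
  ... | no ¬p = ⊥-elim (¬p refl)

  partner-b : partner b ≡ a
  partner-b with b ≟ a | b ≟ b
  ... | yes b≡a | _ = b≡a
  ... | no _ | yes _ = refl
  ... | no _ | no ¬p = ⊥-elim (¬p refl)

  partner-off : ∀ {x} → x ≢ a → x ≢ b → map σ x ≢ a → map σ x ≢ b → partner x ≡ map σ x
  partner-off {x} x≢a x≢b σx≢a σx≢b with x ≟ a | x ≟ b | map σ x ≟ a | map σ x ≟ b
  ... | yes p | _     | _     | _     = ⊥-elim (x≢a p)
  ... | no _  | yes p | _     | _     = ⊥-elim (x≢b p)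
  ... | no _  | no _  | yes p | _     = ⊥-elim (σx≢a p)
  ... | no _  | no _  | no _  | yes p = ⊥-elim (σx≢b p)
  ... | no _  | no _  | no _  | no _  = refl

  partner-fix : ∀ {x} → x ≢ a → x ≢ b → map σ x ≡ a ⊎ map σ x ≡ b → partner x ≡ x
  partner-fix {x} x≢a x≢b hit with x ≟ a | x ≟ b | map σ x ≟ a | map σ x ≟ b
  ... | yes p | _     | _     | _     = ⊥-elim (x≢a p)
  ... | no _  | yes p | _     | _     = ⊥-elim (x≢b p)
  ... | no _  | no _  | yes _ | _     = refl
  ... | no _  | no _  | no _  | yes _ = refl
  ... | no _  | no _  | no p  | no q  = ⊥-elim ([ p , q ] hit)

  partner-involutive : ∀ x → partner (partner x) ≡ x
  partner-involutive x = go (x ≟ a) (x ≟ b) (map σ x ≟ a) (map σ x ≟ b)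
    where
    go : Dec (x ≡ a) → Dec (x ≡ b) → Dec (map σ x ≡ a) → Dec (map σ x ≡ b) → partner (partner x) ≡ x
    go (yes refl) _ _ _ = trans (cong partner partner-a) partner-b
    go (no _) (yes refl) _ _ = trans (cong partner partner-b) partner-a
    go (no p) (no q) (yes r) _ = trans (cong partner fixed) fixed
      where fixed = partner-fix p q (inj₁ r)
    go (no p) (no q) (no _) (yes s) = trans (cong partner fixed) fixed
      where fixed = partner-fix p q (inj₂ s)
    go (no p) (no q) (no r) (no s) =
      trans (cong partner (partner-off p q r s))
        (trans (partner-off r s (p ∘ trans (≡-sym (involutive σ x))) (q ∘ trans (≡-sym (involutive σ x))))
          (involutive σ x))

  rewired : Involution (Fin N)
  rewired = record { map = partner ; involutive = partner-involutive }

-- Colourings of induced subgraphs.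

module Reduction (G : Graph) (deg4 : ∀ v → AtMost 4 (Adj G v)) where

  V : Set
  V = Fin (n G)

  record Edge (W : V → Set) (u v : V) : Set where
    constructor edge
    field
      left     : W u
      right    : W v
      adjacent : Adj G u v
  open Edge hiding (adjacent)

  edge-sym : ∀ {W u v} → Edge W u v → Edge W v u
  edge-sym (edge l r a) = edge r l (adj-sym G a)

  edge-≢ : ∀ {W u v} → Edge W u v → u ≢ v
  edge-≢ e refl = adj-irr G (Edge.adjacent e)

  edge-⊆ : ∀ {W W′ : V → Set} → (∀ {x} → W x → W′ x) → ∀ {u v} → Edge W u v → Edge W′ u v
  edge-⊆ s (edge l r a) = edge (s l) (s r) a

  edge? : ∀ {W} → (∀ x → Dec (W x)) → ∀ u v → Dec (Edge W u v)
  edge? W? u v = map′ (λ (l , r , a) → edge l r a) (λ (edge l r a) → l , r , a)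
    (W? u ×-dec W? v ×-dec (adj G u v ≟ᵇ true))

  edge-without : ∀ {W z u v} → Edge W u v → u ≢ z → v ≢ z → Edge (W ∖ z) u v
  edge-without (edge l r a) u≢z v≢z = edge (l , u≢z) (r , v≢z) a

  degree≤4 : ∀ W v → AtMost 4 (Edge W v)
  degree≤4 W v = atMost-⊆ 4 Edge.adjacent (deg4 v)

  Coloured : (V → Set) → (V → V → Bool) → Bool → V → V → Set
  Coloured W c k u v = Edge W u v × c u v ≡ k

  coloured? : ∀ {W} → (∀ x → Dec (W x)) → ∀ c k u v → Dec (Coloured W c k u v)
  coloured? W? c k u v = edge? W? u v ×-dec (c u v ≟ᵇ k)

  record Linear (W : V → Set) (c : V → V → Bool) : Set₁ where
    field
      symmetric : ∀ u v → c u v ≡ c v u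
      degree≤2  : ∀ k v → AtMost 2 (Coloured W c k v)
      coreless  : ∀ k → NoCore (Coloured W c k)
  open Linear

  linear-⊆ : ∀ {W W′ c} → (∀ {x} → W x → W′ x) → Linear W′ c → Linear W c
  linear-⊆ s lin = record
    { symmetric = symmetric lin
    ; degree≤2  = λ k v → atMost-⊆ 2 (λ (e , eq) → edge-⊆ s e , eq) (degree≤2 lin k v)
    ; coreless  = λ k S (nonempty , dense) → coreless lin k S
        (nonempty , λ x xS → atLeast-⊆ 2 (λ (yS , e , eq) → yS , edge-⊆ s e , eq) (dense x xS))
    }

  -- In a linear colouring such a vertex has exactly two edges, as no colour occurs three times at a vertex.
  record Mono (W : V → Set) (c : V → V → Bool) (v : V) : Set where
    constructor mono
    field
      many : AtLeast 2 (Edge W v)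
      same : ∀ a b → Edge W v a → Edge W v b → c v a ≡ c v b

  mono? : ∀ {W} → (∀ x → Dec (W x)) → ∀ c v → Dec (Mono W c v)
  mono? {W} W? c v = map′ (λ (m , s) → mono m s) (λ (mono m s) → m , s) (many? ×-dec
    all? (λ a → all? (λ b → edge? W? v a →-dec (edge? W? v b →-dec (c v a ≟ᵇ c v b)))))
    where
    many? : Dec (AtLeast 2 (Edge W v))
    many? with atLeast⊎atMost (edge? W? v) 1
    ... | inj₁ many = yes many
    ... | inj₂ few  = no λ many → atLeast-atMost-⊥ 1 many few

  bichromatic : ∀ {W c v a b} → Edge W v a → Edge W v b → c v a ≢ c v b → ¬ Mono W c v
  bichromatic va vb a≢b (mono _ same) = a≢b (same _ _ va vb)

  mono-transfer : ∀ {W W′ c c′ v} → (∀ {y} → Edge W v y → Edge W′ v y × c′ v y ≡ c v y) →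
                  (∀ {y} → Edge W′ v y → Edge W v y) → Mono W c v → Mono W′ c′ v
  mono-transfer to from (mono many same) = mono (atLeast-⊆ 2 (proj₁ ∘ to) many)
    λ a b va vb → trans (proj₂ (to (from va))) (trans (same a b (from va) (from vb)) (≡-sym (proj₂ (to (from vb)))))

  Pairs : (V → Set) → (V → V → Bool) → Involution V → Set
  Pairs W c σ = ∀ v → map σ v ≢ v → ¬ (Mono W c v × Mono W c (map σ v))

  Solvable : (V → Set) → Involution V → Set₁
  Solvable W σ = Σ (V → V → Bool) λ c → Linear W c × Pairs W c σ

  Saturated : (V → Set) → (V → V → Bool) → V → Bool → Set
  Saturated W c x β = ∃ (Coloured W c β x) × AtMost 0 (Coloured W c (not β) x)

  -- With at most two edges present, a colour occurs twice only if it is the colour of all of them.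
  -- This applies to a vertex that has lost two of its four edges.
  mono⊎free : ∀ {W c} → (∀ x → Dec (W x)) → (x : V) → AtMost 2 (Edge W x) →
              (Mono W c x × ∃ (Saturated W c x)) ⊎ (¬ Mono W c x × (∀ k → AtMost 1 (Coloured W c k x)))
  mono⊎free {W} {c} W? x few with mono? W? c x
  ... | yes m@(mono (a , xa , _) same) = inj₁ (m , c x a , (a , xa , refl) ,
          λ y (xy , eq) → not-≢ (c x a) (trans (same a y xa xy) eq))
  ... | no ¬m = inj₂ (¬m , free)
    where
    free : ∀ k → AtMost 1 (Coloured W c k x)
    free k with atLeast⊎atMost (coloured? W? c k x) 1
    ... | inj₂ h = h
    ... | inj₁ (a , (xa , ka) , b , ((xb , kb) , b≢a) , _) =
      ⊥-elim (¬m (mono (pair (≢-sym b≢a) xa xb) λ y z xy xz → trans (all-k y xy) (≡-sym (all-k z xz))))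
      where
      all-k : ∀ y → Edge W x y → c x y ≡ k
      all-k y xy with atMost2-cases few (≢-sym b≢a) xa xb y xy
      ... | inj₁ refl = ka
      ... | inj₂ refl = kb

  -- This keeps `x` from being monochromatic once it receives one new edge of colour `α`: either it
  -- sees the other colour as well, or the new edge is its only one.
  Pendant : (V → Set) → (V → V → Bool) → V → Bool → Set
  Pendant W c x α = ∃ (Coloured W c (not α) x) ⊎ AtMost 0 (Edge W x)

  -- Two edges of each colour would make four, so some colour occurs at most once. If only one
  -- colour is present, the absent one is chosen, so that the opposite colour is always seen unless
  -- there is no edge at all.
  pendant-colour : ∀ {W c} → (∀ x → Dec (W x)) → (x : V) → AtMost 3 (Edge W x) →
                   ∃[ α ] AtMost 1 (Coloured W c α x) × Pendant W c x α
  pendant-colour {W} {c} W? x few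
    with atLeast⊎atMost (coloured? W? c true x) 0 | atLeast⊎atMost (coloured? W? c false x) 0
  ... | inj₂ noT | inj₁ (a , xa , _) = true , atMost-suc 0 noT , inj₁ (a , xa)
  ... | inj₂ noT | inj₂ noF = true , atMost-suc 0 noT , inj₂ none
    where
    none : AtMost 0 (Edge W x)
    none y xy with c x y in eq
    ... | true  = noT y (xy , eq)
    ... | false = noF y (xy , eq)
  ... | inj₁ (a , xa , _) | _ with atLeast⊎atMost (coloured? W? c false x) 1
  ... | inj₂ fewF = false , fewF , inj₁ (a , xa)
  ... | inj₁ (d , (xd , kd) , e , ((xe , ke) , e≢d) , _) with atLeast⊎atMost (coloured? W? c true x) 1
  ... | inj₂ fewT = true , fewT , inj₁ (d , xd , kd)
  ... | inj₁ (a , (xa , ka) , b , ((xb , kb) , b≢a) , _) =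
    ⊥-elim (few a xa b (xb , b≢a) d ((xd , differ kd ka) , differ kd kb) e
      (((xe , differ ke ka) , differ ke kb) , e≢d))
    where
    differ : ∀ {y z} → c x y ≡ false → c x z ≡ true → y ≢ z
    differ f t refl with () ← trans (≡-sym f) t

  pendant-¬mono : ∀ {W W₀ c c₀ x z α} → Pendant W₀ c₀ x α → Edge W x z → c x z ≡ α →
                  (∀ {y} → Edge W x y → y ≡ z ⊎ Edge W₀ x y) →
                  (∀ {y} → Edge W₀ x y → Edge W x y × c x y ≡ c₀ x y) → ¬ Mono W c x
  pendant-¬mono {c = c} {x = x} {z} {α} (inj₁ (a , xa , ka)) xz kz _ lift =
    bichromatic xz (proj₁ (lift xa))
      λ eq → not-≢ α (trans (≡-sym kz) (trans eq (trans (proj₂ (lift xa)) ka)))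
  pendant-¬mono {W} {x = x} {z = z} (inj₂ none) xz kz split lift (mono many _) =
    atLeast-atMost-⊥ 1 many only
    where
    only : AtMost 1 (Edge W x)
    only y xy y′ (xy′ , y′≢y) with split xy | split xy′
    ... | inj₂ e | _ = none _ e
    ... | inj₁ _ | inj₂ e = none _ e
    ... | inj₁ refl | inj₁ refl = y′≢y refl

  -- Inserting a vertex into a linear colouring.

  recolour : (V → V → Bool) → V → (V → Bool) → V → V → Bool
  recolour c z g u v = if does (u ≟ z) then g v else if does (v ≟ z) then g u else c u v

  module Extend (W : V → Set) (z : V) (c : V → V → Bool) (g : V → Bool) where

    c′ : V → V → Bool
    c′ = recolour c z g

    from-z : ∀ y → c′ z y ≡ g y
    from-z y rewrite dec-true (z ≟ z) refl = refl

    to-z : ∀ y → y ≢ z → c′ y z ≡ g y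
    to-z y y≢z rewrite dec-false (y ≟ z) y≢z | dec-true (z ≟ z) refl = refl

    off-z : ∀ {u v} → u ≢ z → v ≢ z → c′ u v ≡ c u v
    off-z {u} {v} u≢z v≢z rewrite dec-false (u ≟ z) u≢z | dec-false (v ≟ z) v≢z = refl

    down : ∀ {k u v} → u ≢ z → v ≢ z → Coloured W c′ k u v → Coloured (W ∖ z) c k u v
    down u≢z v≢z (e , eq) = edge-without e u≢z v≢z , trans (≡-sym (off-z u≢z v≢z)) eq

    keep : ∀ m {k v} → v ≢ z → (Edge W z v → g v ≢ k) →
           AtMost m (Coloured (W ∖ z) c k v) → AtMost m (Coloured W c′ k v)
    keep m {k} {v} v≢z other = atMost-⊆ m (λ {y} → into (y ≟ z))
      where
      into : ∀ {y} → Dec (y ≡ z) → Coloured W c′ k v y → Coloured (W ∖ z) c k v y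
      into (no y≢z) e = down v≢z y≢z e
      into (yes refl) e = ⊥-elim (other (edge-sym (proj₁ e)) (trans (≡-sym (to-z v v≢z)) (proj₂ e)))

    grow : ∀ m {k v} → v ≢ z → AtMost m (Coloured (W ∖ z) c k v) → AtMost (suc m) (Coloured W c′ k v)
    grow m v≢z h = atMost-insert m z (atMost-⊆ m (λ (e , y≢z) → down v≢z y≢z e) h)

    -- A core through `z` contains two neighbours of `z` along edges of colour `k`, that is, all its
    -- neighbours. If one of these had no edge of colour `k` before, its only one now leads to `z`,
    -- which is too few. So a core avoids `z` and lies in the old colouring.
    extend : W z → Linear (W ∖ z) c → AtMost 2 (Edge W z) →
             (∀ y → Edge W z y → AtMost 1 (Coloured (W ∖ z) c (g y) y)) →
             (∀ k → AtMost 1 (λ y → Edge W z y × g y ≡ k) ⊎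
                    (∃[ y ] Edge W z y × AtMost 0 (Coloured (W ∖ z) c k y))) →
             Linear W c′
    extend zW lin few room break = record { symmetric = symm ; degree≤2 = deg ; coreless = core }
      where
      symm : ∀ u v → c′ u v ≡ c′ v u
      symm u v with u ≟ z | v ≟ z
      ... | yes refl | yes refl = refl
      ... | yes refl | no _ = refl
      ... | no _ | yes refl = refl
      ... | no _ | no _ = symmetric lin u v

      deg : ∀ k v → AtMost 2 (Coloured W c′ k v)
      deg k v = go (v ≟ z) (adj G z v ≟ᵇ true) (g v ≟ᵇ k)
        where
        go : Dec (v ≡ z) → Dec (Adj G z v) → Dec (g v ≡ k) → AtMost 2 (Coloured W c′ k v)
        go (yes refl) _ _ = atMost-⊆ 2 proj₁ few
        go (no v≢z) (no ¬zv) _ = keep 2 v≢z (λ zv → ⊥-elim (¬zv (Edge.adjacent zv))) (degree≤2 lin k v)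
        go (no v≢z) (yes _) (no gv≢k) = keep 2 v≢z (λ _ → gv≢k) (degree≤2 lin k v)
        go (no v≢z) (yes zv) (yes refl) x vx =
          grow 1 v≢z (room v (edge zW (left (proj₁ vx)) zv)) x vx

      core : ∀ k → NoCore (Coloured W c′ k)
      core k S (nonempty , dense) = coreless lin k S (nonempty , λ x xS →
          atLeast-⊆ 2 (λ (yS , e) → yS , down (S-≢z xS) (S-≢z yS) e) (dense x xS))
        where
        out-z : ¬ S z
        out-z zS with break k
        ... | inj₁ one = atLeast-atMost-⊥ 1 (dense z zS)
                (atMost-⊆ 1 (λ {y} (_ , e , eq) → e , trans (≡-sym (from-z y)) eq) one)
        ... | inj₂ (y , zy , none) with dense z zS
        ... | a , (aS , za , _) , b , ((bS , zb , _) , b≢a) , _ =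
            atLeast-atMost-⊥ 1 (dense y yS) (atMost-insert 0 z
              (λ x ((_ , e) , x≢z) → none x (down (edge-≢ (edge-sym zy)) x≢z e)))
          where
          yS : S y
          yS with atMost2-cases few (≢-sym b≢a) za zb y zy
          ... | inj₁ refl = aS
          ... | inj₂ refl = bS

        S-≢z : ∀ {x} → S x → x ≢ z
        S-≢z zS refl = out-z zS

  record Degree2 (W : V → Set) (v a b : V) : Set where
    field
      distinct : a ≢ b
      to-a     : Edge W v a
      to-b     : Edge W v b
      only     : ∀ y → Edge W v y → y ≡ a ⊎ y ≡ b
  open Degree2

  degree2-swap : ∀ {W v a b} → Degree2 W v a b → Degree2 W v b a
  degree2-swap d = record { distinct = ≢-sym (distinct d) ; to-a = to-b d ; to-b = to-a d
                          ; only = λ y e → Sum.swap (only d y e) }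

  degree2-without : ∀ {W z v a b} → Degree2 W v a b → v ≢ z → a ≢ z → b ≢ z → Degree2 (W ∖ z) v a b
  degree2-without d v≢z a≢z b≢z = record
    { distinct = distinct d ; to-a = edge-without (to-a d) v≢z a≢z ; to-b = edge-without (to-b d) v≢z b≢z
    ; only = λ y e → only d y (edge-⊆ proj₁ e) }

  degree2-atMost : ∀ {W v a b} → Degree2 W v a b → AtMost 2 (Edge W v)
  degree2-atMost {a = a} {b} d = atMost-insert 1 a (atMost-insert 0 b
    λ y ((e , y≢a) , y≢b) → [ y≢a , y≢b ] (only d y e))

  module Extend₂ (W : V → Set) (z a b : V) (d : Degree2 W z a b) (c : V → V → Bool) (ka kb : Bool) where

    private
      g : V → Bool
      -- Only the values at `a` and `b` matter; `kb` is also the default elsewhere.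
      g y = if does (y ≟ a) then ka else kb

    open Extend W z c g public

    private
      g-a : g a ≡ ka
      g-a rewrite dec-true (a ≟ a) refl = refl

      g-b : g b ≡ kb
      g-b rewrite dec-false (b ≟ a) (≢-sym (distinct d)) = refl

    a≢z : a ≢ z
    a≢z = ≢-sym (edge-≢ (to-a d))

    b≢z : b ≢ z
    b≢z = ≢-sym (edge-≢ (to-b d))

    at-a : c′ a z ≡ ka
    at-a = trans (to-z a a≢z) g-a

    at-b : c′ b z ≡ kb
    at-b = trans (to-z b b≢z) g-b

    from-a : c′ z a ≡ ka
    from-a = trans (from-z a) g-a

    from-b : c′ z b ≡ kb
    from-b = trans (from-z b) g-b

    keep-a : ∀ m {k} → ka ≢ k → AtMost m (Coloured (W ∖ z) c k a) → AtMost m (Coloured W c′ k a)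
    keep-a m ka≢k = keep m a≢z (λ _ eq → ka≢k (trans (≡-sym g-a) eq))

    keep-b : ∀ m {k} → kb ≢ k → AtMost m (Coloured (W ∖ z) c k b) → AtMost m (Coloured W c′ k b)
    keep-b m kb≢k = keep m b≢z (λ _ eq → kb≢k (trans (≡-sym g-b) eq))

    keep-other : ∀ m {k v} → v ≢ z → v ≢ a → v ≢ b →
                 AtMost m (Coloured (W ∖ z) c k v) → AtMost m (Coloured W c′ k v)
    keep-other m v≢z v≢a v≢b = keep m v≢z (λ zv → ⊥-elim ([ v≢a , v≢b ] (only d _ zv)))

    not-a : ∀ {k y} → ka ≢ k → Coloured W c′ k z y → y ≡ b
    not-a ka≢k (e , eq) with only d _ e
    ... | inj₁ refl = ⊥-elim (ka≢k (trans (≡-sym from-a) eq))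
    ... | inj₂ y≡b  = y≡b

    not-b : ∀ {k y} → kb ≢ k → Coloured W c′ k z y → y ≡ a
    not-b kb≢k (e , eq) with only d _ e
    ... | inj₁ y≡a  = y≡a
    ... | inj₂ refl = ⊥-elim (kb≢k (trans (≡-sym from-b) eq))

    new-a : ∀ {k} → kb ≢ k → AtMost 1 (Coloured W c′ k z)
    new-a kb≢k y e y′ (e′ , y′≢y) = y′≢y (trans (not-b kb≢k e′) (≡-sym (not-b kb≢k e)))

    new-b : ∀ {k} → ka ≢ k → AtMost 1 (Coloured W c′ k z)
    new-b ka≢k y e y′ (e′ , y′≢y) = y′≢y (trans (not-a ka≢k e′) (≡-sym (not-a ka≢k e)))

    new-none : ∀ {k} → ka ≢ k → kb ≢ k → AtMost 0 (Coloured W c′ k z)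
    new-none ka≢k kb≢k y e = distinct d (trans (≡-sym (not-b kb≢k e)) (not-a ka≢k e))

    extend₂ : Linear (W ∖ z) c →
              AtMost 1 (Coloured (W ∖ z) c ka a) → AtMost 1 (Coloured (W ∖ z) c kb b) →
              ka ≢ kb ⊎ AtMost 0 (Coloured (W ∖ z) c ka a) ⊎ AtMost 0 (Coloured (W ∖ z) c kb b) →
              Linear W c′
    extend₂ lin room-a room-b break = extend (left (to-a d)) lin (degree2-atMost d) room breaks
      where
      room : ∀ y → Edge W z y → AtMost 1 (Coloured (W ∖ z) c (g y) y)
      room y e with only d y e
      ... | inj₁ refl = subst (λ k → AtMost 1 (Coloured (W ∖ z) c k a)) (≡-sym g-a) room-a
      ... | inj₂ refl = subst (λ k → AtMost 1 (Coloured (W ∖ z) c k b)) (≡-sym g-b) room-b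

      few : ∀ {k} → ka ≢ k ⊎ kb ≢ k → AtMost 1 (λ y → Edge W z y × g y ≡ k)
      few (inj₁ ka≢k) = atMost-⊆ 1 (λ {y} (e , eq) → e , trans (from-z y) eq) (new-b ka≢k)
      few (inj₂ kb≢k) = atMost-⊆ 1 (λ {y} (e , eq) → e , trans (from-z y) eq) (new-a kb≢k)

      breaks : ∀ k → AtMost 1 (λ y → Edge W z y × g y ≡ k) ⊎
                     (∃[ y ] Edge W z y × AtMost 0 (Coloured (W ∖ z) c k y))
      breaks k with ka ≟ᵇ k | kb ≟ᵇ k
      ... | no ka≢k | _ = inj₁ (few (inj₁ ka≢k))
      ... | yes _ | no kb≢k = inj₁ (few (inj₂ kb≢k))
      ... | yes refl | yes kb≡ka = [ (λ ka≢kb → ⊥-elim (ka≢kb (≡-sym kb≡ka)))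
        , [ (λ none → inj₂ (a , to-a d , none))
          , (λ none → inj₂ (b , to-b d , subst (λ k → AtMost 0 (Coloured (W ∖ z) c k b)) kb≡ka none)) ] ] break

  -- Restoring the pairs after an insertion.

  -- `Z` is the set of inserted vertices. By `touched`, a monochromatic vertex outside `Z` has no
  -- edge into `Z`, so it was monochromatic before the insertion.
  module Finish {W W₀ Z : V → Set} {c c₀ : V → V → Bool} (Z? : ∀ x → Dec (Z x))
    (inside : ∀ {x} → W x → ¬ Z x → W₀ x) (outside : ∀ {x} → W₀ x → W x)
    (agree : ∀ {u v} → W₀ u → W₀ v → c u v ≡ c₀ u v)
    (touched : ∀ {x z} → Z z → Edge W x z → ¬ Z x → ¬ Mono W c x) where

    mono-old : ∀ {v} → ¬ Z v → Mono W c v → Mono W₀ c₀ v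
    mono-old {v} ¬Zv m = mono-transfer (λ e → old e , ≡-sym (agree (left (old e)) (right (old e))))
                           (edge-⊆ outside) m
      where
      old : ∀ {y} → Edge W v y → Edge W₀ v y
      old {y} e with Z? y
      ... | yes Zy = ⊥-elim (touched Zy e ¬Zv m)
      ... | no ¬Zy = edge (inside (left e) ¬Zv) (inside (right e) ¬Zy) (Edge.adjacent e)

    -- The involutions have to agree only where both partners are monochromatic at the end, which is
    -- what permits a rewiring to break the pairs of touched vertices.
    pairs : (σ τ : Involution V) →
      (∀ {z} → Z z → Mono W c z →
        (∀ {z′} → Z z′ → Mono W c z′ → z′ ≡ z) × (¬ Z (map σ z) → ¬ Mono W c (map σ z))) →
      (∀ {v} → ¬ Z v → ¬ Z (map σ v) → Mono W c v → Mono W c (map σ v) → map τ v ≡ map σ v) →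
      Pairs W₀ c₀ τ → Pairs W c σ
    pairs σ τ lone same pairs₀ v σv≢v (m , m′) with Z? v | Z? (map σ v)
    ... | yes Zv | yes Zσv = σv≢v (proj₁ (lone Zv m) Zσv m′)
    ... | yes Zv | no ¬Zσv = proj₂ (lone Zv m) ¬Zσv m′
    ... | no ¬Zv | yes Zσv = proj₂ (lone Zσv m′) (subst (λ x → ¬ Z x) (≡-sym (involutive σ v)) ¬Zv)
                               (subst (Mono W c) (≡-sym (involutive σ v)) m)
    ... | no ¬Zv | no ¬Zσv with same ¬Zv ¬Zσv m m′
    ... | τv≡σv = pairs₀ v (λ eq → σv≢v (trans (≡-sym τv≡σv) eq))
                    (mono-old ¬Zv m , subst (Mono W₀ c₀) (≡-sym τv≡σv) (mono-old ¬Zσv m′))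

  degree-drop : ∀ m {W x z} → AtMost (suc m) (Edge W x) → Edge W x z → AtMost m (Edge (W ∖ z) x)
  degree-drop m few xz = atMost-⊆ m (λ e → edge-⊆ proj₁ e , proj₂ (right e)) (few _ xz)

  -- A vertex of degree at most 1.

  -- Neither `v`, having at most one edge, nor its neighbour, by the choice of the colour, is
  -- monochromatic afterwards; so `σ` needs no rewiring.
  add-low : ∀ {W} → (∀ x → Dec (W x)) → (σ : Involution V) (v : V) → W v → AtMost 1 (Edge W v) →
            Solvable (W ∖ v) σ → Solvable W σ
  add-low {W} W? σ v vW few (c , lin , prs) with choice
    where
    choice : ∃[ α ] (∀ y → Edge W v y → AtMost 1 (Coloured (W ∖ v) c α y)) ×
                    (∀ x → Edge W x v → ¬ Mono W (recolour c v (λ _ → α)) x)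
    choice with atLeast⊎atMost (edge? W? v) 0
    -- Without an edge at `v` any colour will do.
    ... | inj₂ none = true , (λ y e → ⊥-elim (none y e)) , λ x e → ⊥-elim (none x (edge-sym e))
    ... | inj₁ (u , vu , _)
      with pendant-colour {c = c} (remove? W? v) u (degree-drop 3 (degree≤4 W u) (edge-sym vu))
    ... | α , room , pendant = α , (λ y e → subst (λ y → AtMost 1 (Coloured (W ∖ v) c α y)) (≡-sym (only-u e)) room) ,
      λ x e → subst (λ x → ¬ Mono W (recolour c v (λ _ → α)) x) (≡-sym (only-u (edge-sym e)))
        (pendant-¬mono {c₀ = c} pendant (edge-sym vu) (to-z u (edge-≢ (edge-sym vu))) split
          (λ e′ → edge-⊆ proj₁ e′ , off-z (proj₂ (left e′)) (proj₂ (right e′))))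
      where
      open Extend W v c (λ _ → α)
      only-u : ∀ {y} → Edge W v y → y ≡ u
      only-u {y} e with y ≟ u
      ... | yes y≡u = y≡u
      ... | no y≢u = ⊥-elim (few u vu y (e , y≢u))
      split : ∀ {y} → Edge W u y → y ≡ v ⊎ Edge (W ∖ v) u y
      split {y} e with y ≟ v
      ... | yes y≡v = inj₁ y≡v
      ... | no y≢v = inj₂ (edge-without e (edge-≢ (edge-sym vu)) y≢v)
  ... | α , room , touched = c′ ,
      extend vW lin (atMost-suc 1 few) room (λ k → inj₁ (atMost-⊆ 1 proj₁ few)) ,
      F.pairs σ σ (λ { refl m → ⊥-elim (atLeast-atMost-⊥ 1 (Mono.many m) few) }) (λ _ _ _ _ → refl) prs
    where
    open Extend W v c (λ _ → α)
    touched′ : ∀ {x z} → z ≡ v → Edge W x z → x ≢ v → ¬ Mono W c′ x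
    touched′ {x} refl e _ = touched x e
    module F = Finish {W} {W ∖ v} {_≡ v} {c′} {c} (_≟ v) (λ w ne → w , ne) proj₁
      (λ u v → off-z (proj₂ u) (proj₂ v)) touched′

  -- Two adjacent vertices of degree 2.

  -- The edges of the path `x`, `u`, `v`, `y` get the colours `α`, `γ`, `β`. If `α` and `β` differ,
  -- exactly one of `u`, `v` is monochromatic and `γ` decides which; pairing their partners in the
  -- smaller graph makes one of the two choices admissible.
  module AdjacentTwos {W : V → Set} (W? : ∀ x → Dec (W x)) (σ : Involution V) {u v x y : V}
    (du : Degree2 W u v x) (dv : Degree2 W v u y) where

    W₀ : V → Set
    W₀ = W ∖ v ∖ u

    W₀? : ∀ z → Dec (W₀ z)
    W₀? = remove? (remove? W? v) u

    u≢v : u ≢ v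
    u≢v = edge-≢ (to-a du)

    x≢u : x ≢ u
    x≢u = edge-≢ (edge-sym (to-b du))

    x≢v : x ≢ v
    x≢v = ≢-sym (distinct du)

    y≢u : y ≢ u
    y≢u = ≢-sym (distinct dv)

    y≢v : y ≢ v
    y≢v = edge-≢ (edge-sym (to-b dv))

    -- The ends may coincide, in which case `x` receives both outer edges at once; this is why the
    -- conditions at the ends are split according to `x ≡ y`. No cycle arises because `α`, `γ` and
    -- `β` are not all equal.
    module Build (c : V → V → Bool) (lin : Linear W₀ c) (prs : Pairs W₀ c (Rewire.rewired σ (map σ u) (map σ v)))
      (α β γ : Bool) (room-x : AtMost 1 (Coloured W₀ c α x)) (room-y : AtMost 1 (Coloured W₀ c β y))
      (room-xy : x ≡ y → α ≡ β → AtMost 0 (Coloured W₀ c α x))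
      (end-x : x ≢ y → Pendant W₀ c x α) (end-y : x ≢ y → Pendant W₀ c y β)
      (end-xy : x ≡ y → α ≢ β ⊎ ∃ (Coloured W₀ c (not α) x))
      (γ-breaks : γ ≡ β → α ≢ β)
      (u-lone : α ≡ γ → ¬ Mono W₀ c (map σ u)) (v-lone : γ ≡ β → ¬ Mono W₀ c (map σ v)) where

      private
        module S₁ = Extend (W ∖ v) u c (λ _ → α)

      only-x : ∀ {z} → Edge (W ∖ v) u z → z ≡ x
      only-x e with only du _ (edge-⊆ proj₁ e)
      ... | inj₁ z≡v = ⊥-elim (proj₂ (right e) z≡v)
      ... | inj₂ z≡x = z≡x

      one-u : AtMost 1 (Edge (W ∖ v) u)
      one-u z e z′ (e′ , z′≢z) = z′≢z (trans (only-x e′) (≡-sym (only-x e)))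

      lin₁ : Linear (W ∖ v) S₁.c′
      lin₁ = S₁.extend (left (to-a du) , u≢v) lin (atMost-suc 1 one-u)
        (λ z e → subst (λ z → AtMost 1 (Coloured W₀ c α z)) (≡-sym (only-x e)) room-x)
        (λ k → inj₁ (atMost-⊆ 1 proj₁ one-u))

      private
        module S₂ = Extend₂ W v y u (degree2-swap dv) S₁.c′ β γ

      room-y₁ : AtMost 1 (Coloured (W ∖ v) S₁.c′ β y)
      room-y₁ with x ≟ y | α ≟ᵇ β
      ... | yes refl | yes refl = S₁.grow 0 x≢u (room-xy refl refl)
      ... | _ | no α≢β = S₁.keep 1 y≢u (λ _ → α≢β) room-y
      ... | no x≢y | _ = S₁.keep 1 y≢u (λ e → ⊥-elim (x≢y (≡-sym (only-x e)))) room-y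

      break : β ≢ γ ⊎ AtMost 0 (Coloured (W ∖ v) S₁.c′ β y) ⊎ AtMost 0 (Coloured (W ∖ v) S₁.c′ γ u)
      break with β ≟ᵇ γ
      ... | no β≢γ = inj₁ β≢γ
      -- So far `u` has only the edge to `x`, whose colour `α` differs from `γ`; the new path stops
      -- at `u`.
      ... | yes refl = inj₂ (inj₂ λ z (e , eq) → γ-breaks refl (trans (≡-sym (S₁.from-z z)) eq))

      lin₂ : Linear W S₂.c′
      lin₂ = S₂.extend₂ lin₁ room-y₁ (atMost-⊆ 1 proj₁ one-u) break

      c₂ : V → V → Bool
      c₂ = S₂.c′

      xu : c₂ x u ≡ α
      xu = trans (S₂.off-z x≢v u≢v) (S₁.to-z x x≢u)

      ux : c₂ u x ≡ α
      ux = trans (S₂.off-z u≢v x≢v) (S₁.from-z x)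

      agree : ∀ {s t} → W₀ s → W₀ t → c₂ s t ≡ c s t
      agree ((_ , s≢v) , s≢u) ((_ , t≢v) , t≢u) = trans (S₂.off-z s≢v t≢v) (S₁.off-z s≢u t≢u)

      lift : ∀ {s t} → Edge W₀ s t → Edge W s t × c₂ s t ≡ c s t
      lift e = edge-⊆ (proj₁ ∘ proj₁) e , agree (left e) (right e)

      split : ∀ {s t} → s ≢ v → s ≢ u → Edge W s t → t ≡ v ⊎ t ≡ u ⊎ Edge W₀ s t
      split {t = t} s≢v s≢u e with t ≟ v | t ≟ u
      ... | yes p | _ = inj₁ p
      ... | no _ | yes p = inj₂ (inj₁ p)
      ... | no p | no q = inj₂ (inj₂ (edge-without (edge-without e s≢v p) s≢u q))

      x-¬mono : ¬ Mono W c₂ x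
      y-¬mono : ¬ Mono W c₂ y
      x-¬mono with x ≟ y
      ... | no x≢y = pendant-¬mono {c₀ = c} (end-x x≢y) (edge-sym (to-b du)) xu only-u lift
        where
        only-u : ∀ {t} → Edge W x t → t ≡ u ⊎ Edge W₀ x t
        only-u e with split x≢v x≢u e
        ... | inj₂ r = r
        ... | inj₁ refl = ⊥-elim ([ x≢u , x≢y ] (only dv x (edge-sym e)))
      ... | yes refl with end-xy refl
      ... | inj₁ α≢β = bichromatic (edge-sym (to-b du)) (edge-sym (to-b dv))
              λ eq → α≢β (trans (≡-sym xu) (trans eq S₂.at-a))
      ... | inj₂ (s , e , k) = bichromatic (edge-sym (to-b du)) (proj₁ (lift e))
              λ eq → not-≢ α (trans (≡-sym xu) (trans eq (trans (proj₂ (lift e)) k)))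
      y-¬mono with x ≟ y
      ... | yes refl = x-¬mono
      ... | no x≢y = pendant-¬mono {c₀ = c} (end-y x≢y) (edge-sym (to-b dv)) S₂.at-a only-v lift
        where
        only-v : ∀ {t} → Edge W y t → t ≡ v ⊎ Edge W₀ y t
        only-v e with split y≢v y≢u e
        ... | inj₁ r = inj₁ r
        ... | inj₂ (inj₂ r) = inj₂ r
        ... | inj₂ (inj₁ refl) = ⊥-elim ([ y≢v , x≢y ∘ ≡-sym ] (only du y (edge-sym e)))

      Z : V → Set
      Z t = t ≡ u ⊎ t ≡ v

      touched : ∀ {s z} → Z z → Edge W s z → ¬ Z s → ¬ Mono W c₂ s
      touched (inj₁ refl) e ¬Z with only du _ (edge-sym e)
      ... | inj₁ refl = ⊥-elim (¬Z (inj₂ refl))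
      ... | inj₂ refl = x-¬mono
      touched (inj₂ refl) e ¬Z with only dv _ (edge-sym e)
      ... | inj₁ refl = ⊥-elim (¬Z (inj₁ refl))
      ... | inj₂ refl = y-¬mono

      private
        module F = Finish {W} {W₀} {Z} {c₂} {c} (λ t → (t ≟ u) ⊎-dec (t ≟ v))
          (λ w ¬Z → (w , ¬Z ∘ inj₂) , ¬Z ∘ inj₁) (proj₁ ∘ proj₁) agree touched

      u-mono : Mono W c₂ u → α ≡ γ
      u-mono m = trans (≡-sym ux) (trans (Mono.same m x v (to-b du) (to-a du)) S₂.at-b)

      v-mono : Mono W c₂ v → γ ≡ β
      v-mono m = trans (≡-sym S₂.from-b) (trans (Mono.same m u y (to-a dv) (to-b dv)) S₂.from-a)

      both : α ≡ γ → γ ≡ β → ⊥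
      both α≡γ γ≡β = γ-breaks γ≡β (trans α≡γ γ≡β)

      lone : ∀ {z} → Z z → Mono W c₂ z →
        (∀ {z′} → Z z′ → Mono W c₂ z′ → z′ ≡ z) × (¬ Z (map σ z) → ¬ Mono W c₂ (map σ z))
      lone (inj₁ refl) m =
        (λ { (inj₁ p) _ → p ; (inj₂ refl) m′ → ⊥-elim (both (u-mono m) (v-mono m′)) }) ,
        λ ¬Z m′ → u-lone (u-mono m) (F.mono-old ¬Z m′)
      lone (inj₂ refl) m =
        (λ { (inj₂ p) _ → p ; (inj₁ refl) m′ → ⊥-elim (both (u-mono m′) (v-mono m)) }) ,
        λ ¬Z m′ → v-lone (v-mono m) (F.mono-old ¬Z m′)

      open Rewire σ (map σ u) (map σ v)

      same : ∀ {t} → ¬ Z t → ¬ Z (map σ t) → Mono W c₂ t → Mono W c₂ (map σ t) → map rewired t ≡ map σ t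
      same ¬Zt ¬Zσt _ _ = partner-off (λ p → ¬Zσt (inj₁ (trans (cong (map σ) p) (involutive σ u))))
        (λ p → ¬Zσt (inj₂ (trans (cong (map σ) p) (involutive σ v))))
        (¬Zt ∘ inj₁ ∘ injective σ) (¬Zt ∘ inj₂ ∘ injective σ)

      solution : Solvable W σ
      solution = c₂ , lin₂ , F.pairs σ rewired lone same prs

    open Rewire σ (map σ u) (map σ v)

    solve : (∀ τ → Solvable W₀ τ) → Solvable W σ
    solve smaller with smaller rewired
    ... | c , lin , prs with ends
      where
      Ends : Set
      Ends = ∃[ α ] ∃[ β ] AtMost 1 (Coloured W₀ c α x) × AtMost 1 (Coloured W₀ c β y) ×
        (x ≡ y → α ≡ β → AtMost 0 (Coloured W₀ c α x)) ×
        (x ≢ y → Pendant W₀ c x α) × (x ≢ y → Pendant W₀ c y β) ×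
        (x ≡ y → α ≢ β ⊎ ∃ (Coloured W₀ c (not α) x))
      drop-u : ∀ m {s} → AtMost (suc m) (Edge W s) → s ≢ v → Edge W s u → AtMost m (Edge W₀ s)
      drop-u m few s≢v e = atMost-⊆ m (λ e′ → edge-⊆ (proj₁ ∘ proj₁) e′ , proj₂ (right e′)) (few _ e)
      ends : Ends
      ends with x ≟ y
      ... | no x≢y
        with pendant-colour {c = c} W₀? x (drop-u 3 (degree≤4 W x) x≢v (edge-sym (to-b du)))
           | pendant-colour {c = c} W₀? y
               (atMost-⊆ 3 (λ e′ → edge-⊆ (proj₁ ∘ proj₁) e′ , proj₂ (proj₁ (right e′)))
                 (degree≤4 W y v (edge-sym (to-b dv))))
      ... | α , room-x , px | β , room-y , py =
        α , β , room-x , room-y , (λ p → ⊥-elim (x≢y p)) , (λ _ → px) , (λ _ → py) , λ p → ⊥-elim (x≢y p)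
      ends | yes refl
        with mono⊎free {c = c} W₀? x
          (degree-drop 2 (degree-drop 3 (degree≤4 W x) (edge-sym (to-b dv)))
            (edge-without (edge-sym (to-b du)) x≢v u≢v))
      -- Each colour has room for one edge at the common end, and using both makes it bichromatic.
      -- In the other case the absent colour is used twice, against the colour already there.
      ... | inj₂ (_ , free) = true , false , free true , free false , (λ _ ()) ,
              (λ p → ⊥-elim (p refl)) , (λ p → ⊥-elim (p refl)) , λ _ → inj₁ λ ()
      ... | inj₁ (_ , k , (a , xa) , none) = not k , not k , atMost-suc 0 none , atMost-suc 0 none ,
              (λ _ _ → none) , (λ p → ⊥-elim (p refl)) , (λ p → ⊥-elim (p refl)) ,
              λ _ → inj₂ (a , subst (λ k → Coloured W₀ c k x a) (≡-sym (not-involutive k)) xa)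
    ... | α , β , room-x , room-y , room-xy , px , py , pxy with α ≟ᵇ β
    ... | yes refl = Build.solution c lin prs α α (not α) room-x room-y room-xy px py pxy
            (λ eq → ⊥-elim (not-≢ α (≡-sym eq))) (λ eq → ⊥-elim (not-≢ α eq)) (λ eq → ⊥-elim (not-≢ α (≡-sym eq)))
    -- `γ ≡ α` makes `u` monochromatic, which is allowed if its partner is not. Otherwise `γ ≡ β`
    -- makes `v` monochromatic, and the rewired pair excludes the partner of `v`.
    ... | no α≢β with mono? W₀? c (map σ u)
    ... | no ¬m = Build.solution c lin prs α β α room-x room-y room-xy px py pxy
            (λ eq → α≢β) (λ _ → ¬m) (λ eq → ⊥-elim (α≢β eq))
    ... | yes m = Build.solution c lin prs α β β room-x room-y room-xy px py pxy
            (λ _ → α≢β) (λ eq → ⊥-elim (α≢β eq))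
            (λ _ m′ → prs (map σ u) (λ eq → u≢v (injective σ (trans (≡-sym eq) partner-a)))
              (m , subst (Mono W₀ c) (≡-sym partner-a) m′))

  -- Two vertices of degree 2 with the same neighbours.

  -- The vertex x can receive two new edges, coloured k and l, and is not monochromatic afterwards.
  Port : (V → Set) → (V → V → Bool) → V → Bool → Bool → Set
  Port W c x k l = (k ≢ l × AtMost 1 (Coloured W c k x) × AtMost 1 (Coloured W c l x)) ⊎
                   (k ≡ l × AtMost 0 (Coloured W c k x) × ∃ (Coloured W c (not k) x))

  port-room : ∀ {W c x k l} → Port W c x k l → AtMost 1 (Coloured W c k x)
  port-room (inj₁ (_ , room , _)) = room
  port-room (inj₂ (_ , none , _)) = atMost-suc 0 none

  port-¬mono : ∀ {W W₀ c c₀ x k l s t} → Port W₀ c₀ x k l →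
               (∀ {y} → Edge W₀ x y → Edge W x y × c x y ≡ c₀ x y) →
               Edge W x s → c x s ≡ k → Edge W x t → c x t ≡ l → ¬ Mono W c x
  port-¬mono (inj₁ (k≢l , _)) lift xs ks xt kt =
    bichromatic xs xt λ eq → k≢l (trans (≡-sym ks) (trans eq kt))
  port-¬mono {k = k} (inj₂ (_ , _ , y , xy , ky)) lift xs ks xt kt =
    bichromatic xs (proj₁ (lift xy)) λ eq → not-≢ k (trans (≡-sym ks) (trans eq (trans (proj₂ (lift xy)) ky)))

  module Twins {W : V → Set} (σ : Involution V) {u₁ u₂ w p : V} (u₁≢u₂ : u₁ ≢ u₂)
    (d₁ : Degree2 W u₁ w p) (d₂ : Degree2 W u₂ w p) where

    W₀ : V → Set
    W₀ = W ∖ u₂ ∖ u₁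

    w≢u₁ : w ≢ u₁
    w≢u₁ = edge-≢ (edge-sym (to-a d₁))

    w≢u₂ : w ≢ u₂
    w≢u₂ = edge-≢ (edge-sym (to-a d₂))

    p≢u₁ : p ≢ u₁
    p≢u₁ = edge-≢ (edge-sym (to-b d₁))

    p≢u₂ : p ≢ u₂
    p≢u₂ = edge-≢ (edge-sym (to-b d₂))

    -- The rewiring may change the partners of `w` and `p` freely, because neither is monochromatic
    -- after the insertion.
    Clear : V → Set
    Clear t = t ≢ u₁ × t ≢ u₂ × t ≢ w × t ≢ p

    -- `k₁`, `k₂` colour the edges from `w` to `u₁`, `u₂`, and `l₁`, `l₂` those from `p`. Only `u₁`
    -- may become monochromatic, and then `break` makes its colour new at `p`, so that no cycle is
    -- closed.
    module Build (c : V → V → Bool) (lin : Linear W₀ c) (τ : Involution V) (prs : Pairs W₀ c τ)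
      (unchanged : ∀ {t} → Clear t → Clear (map σ t) → map τ t ≡ map σ t)
      (k₁ l₁ k₂ l₂ : Bool) (k₁≢k₂ : k₁ ≢ k₂)
      (room₁ : AtMost 1 (Coloured W₀ c k₁ w)) (room₂ : AtMost 1 (Coloured W₀ c k₂ w))
      (port : Port W₀ c p l₁ l₂) (break : k₁ ≢ l₁ ⊎ AtMost 0 (Coloured W₀ c l₁ p)) (k₂≢l₂ : k₂ ≢ l₂)
      (u₁-lone : k₁ ≡ l₁ → map σ u₁ ≢ w → map σ u₁ ≢ p → ¬ Mono W₀ c (map σ u₁)) where

      private
        module S₁ = Extend₂ (W ∖ u₂) u₁ w p (degree2-without d₁ u₁≢u₂ w≢u₂ p≢u₂) c k₁ l₁
        module S₂ = Extend₂ W u₂ w p d₂ S₁.c′ k₂ l₂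

      c₂ : V → V → Bool
      c₂ = S₂.c′

      port₁ : Port W₀ c p l₁ l₂ → AtMost 1 (Coloured (W ∖ u₂) S₁.c′ l₂ p)
      port₁ (inj₁ (l₁≢l₂ , _ , room)) = S₁.keep-b 1 l₁≢l₂ room
      port₁ (inj₂ (refl , none , _))  = S₁.grow 0 p≢u₁ none

      lin₂ : Linear W c₂
      lin₂ = S₂.extend₂ (S₁.extend₂ lin room₁ (port-room {c = c} port) (Sum.map₂ inj₂ break))
        (S₁.keep-a 1 k₁≢k₂ room₂) (port₁ port) (inj₁ k₂≢l₂)

      agree : ∀ {s t} → W₀ s → W₀ t → c₂ s t ≡ c s t
      agree ((_ , s≢u₂) , s≢u₁) ((_ , t≢u₂) , t≢u₁) = trans (S₂.off-z s≢u₂ t≢u₂) (S₁.off-z s≢u₁ t≢u₁)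

      w-¬mono : ¬ Mono W c₂ w
      w-¬mono = bichromatic (edge-sym (to-a d₁)) (edge-sym (to-a d₂)) λ eq → k₁≢k₂
        (trans (≡-sym (trans (S₂.off-z w≢u₂ u₁≢u₂) S₁.at-a)) (trans eq S₂.at-a))

      p-¬mono : ¬ Mono W c₂ p
      p-¬mono = port-¬mono {c₀ = c} port
        (λ e → edge-⊆ (proj₁ ∘ proj₁) e , agree (left e) (right e))
        (edge-sym (to-b d₁)) (trans (S₂.off-z p≢u₂ u₁≢u₂) S₁.at-b) (edge-sym (to-b d₂)) S₂.at-b

      Z : V → Set
      Z t = t ≡ u₁ ⊎ t ≡ u₂

      touched : ∀ {s z} → Z z → Edge W s z → ¬ Z s → ¬ Mono W c₂ s
      touched (inj₁ refl) e _ with only d₁ _ (edge-sym e)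
      ... | inj₁ refl = w-¬mono
      ... | inj₂ refl = p-¬mono
      touched (inj₂ refl) e _ with only d₂ _ (edge-sym e)
      ... | inj₁ refl = w-¬mono
      ... | inj₂ refl = p-¬mono

      private
        module F = Finish {W} {W₀} {Z} {c₂} {c} (λ t → (t ≟ u₁) ⊎-dec (t ≟ u₂))
          (λ w ¬Z → (w , ¬Z ∘ inj₂) , ¬Z ∘ inj₁) (proj₁ ∘ proj₁) agree touched

      u₁-mono : Mono W c₂ u₁ → k₁ ≡ l₁
      u₁-mono m = trans (≡-sym (trans (S₂.off-z u₁≢u₂ w≢u₂) S₁.from-a))
        (trans (Mono.same m w p (to-a d₁) (to-b d₁)) (trans (S₂.off-z u₁≢u₂ p≢u₂) S₁.from-b))

      u₂-¬mono : ¬ Mono W c₂ u₂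
      u₂-¬mono = bichromatic (to-a d₂) (to-b d₂)
        λ eq → k₂≢l₂ (trans (≡-sym S₂.from-a) (trans eq S₂.from-b))

      lone : ∀ {z} → Z z → Mono W c₂ z →
        (∀ {z′} → Z z′ → Mono W c₂ z′ → z′ ≡ z) × (¬ Z (map σ z) → ¬ Mono W c₂ (map σ z))
      lone (inj₂ refl) m = ⊥-elim (u₂-¬mono m)
      lone (inj₁ refl) m =
        (λ { (inj₁ eq) _ → eq ; (inj₂ refl) m′ → ⊥-elim (u₂-¬mono m′) }) ,
        λ ¬Z m′ → u₁-lone (u₁-mono m)
          (λ eq → w-¬mono (subst (Mono W c₂) eq m′)) (λ eq → p-¬mono (subst (Mono W c₂) eq m′)) (F.mono-old ¬Z m′)

      clear : ∀ {t} → ¬ Z t → Mono W c₂ t → Clear t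
      clear ¬Z m = ¬Z ∘ inj₁ , ¬Z ∘ inj₂ , (λ { refl → w-¬mono m }) , λ { refl → p-¬mono m }

      solution : Solvable W σ
      solution = c₂ , lin₂ , F.pairs σ τ lone (λ ¬Z ¬Z′ m m′ → unchanged (clear ¬Z m) (clear ¬Z′ m′)) prs

  saturated-port : ∀ {W c x β} → Saturated W c x β → Port W c x (not β) (not β)
  saturated-port {W} {c} {x} {β} ((a , xa) , none) =
    inj₂ (refl , none , a , subst (λ k → Coloured W c k x a) (≡-sym (not-involutive β)) xa)

  -- At `p` both new edges must get `not β`, while `w` is only known to have room for one edge of
  -- each colour. So one of `u₁`, `u₂` has to be monochromatic; here it is `u₁`.
  twins-forced : ∀ {W} (σ : Involution V) {u₁ u₂ w p : V} (u₁≢u₂ : u₁ ≢ u₂)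
    (d₁ : Degree2 W u₁ w p) (d₂ : Degree2 W u₂ w p)
    (c : V → V → Bool) → Linear (W ∖ u₂ ∖ u₁) c → (τ : Involution V) → Pairs (W ∖ u₂ ∖ u₁) c τ →
    (∀ {t} → Twins.Clear σ u₁≢u₂ d₁ d₂ t → Twins.Clear σ u₁≢u₂ d₁ d₂ (map σ t) → map τ t ≡ map σ t) →
    (∀ k → AtMost 1 (Coloured (W ∖ u₂ ∖ u₁) c k w)) → ∀ {β} → Saturated (W ∖ u₂ ∖ u₁) c p β →
    (map σ u₁ ≢ w → map σ u₁ ≢ p → ¬ Mono (W ∖ u₂ ∖ u₁) c (map σ u₁)) → Solvable W σ
  twins-forced σ u₁≢u₂ d₁ d₂ c lin τ prs unchanged free {β} sat lone =
    Twins.Build.solution σ u₁≢u₂ d₁ d₂ c lin τ prs unchanged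
      (not β) (not β) (not (not β)) (not β) (not-≢ _) (free _) (free _)
      (saturated-port {c = c} sat) (inj₂ (proj₂ sat)) (≢-sym (not-≢ _)) λ _ → lone

  -- Pairing w with p rules out that the new edges at both of them are all forced to have one colour.
  module SolveTwins {W : V → Set} (W? : ∀ x → Dec (W x)) (σ : Involution V) {u₁ u₂ w p : V} (u₁≢u₂ : u₁ ≢ u₂)
    (d₁ : Degree2 W u₁ w p) (d₂ : Degree2 W u₂ w p) where

    open Twins σ u₁≢u₂ d₁ d₂ using (W₀; Clear; w≢u₁; w≢u₂; p≢u₁; p≢u₂)

    private
      module R₀ = Rewire σ w p
      σ₀ = R₀.rewired
      q₁ = map σ₀ u₁
      q₂ = map σ₀ u₂
      module R = Rewire σ₀ q₁ q₂
      τ = R.rewired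

      W₀? : ∀ z → Dec (W₀ z)
      W₀? = remove? (remove? W? u₂) u₁

      w≢p : w ≢ p
      w≢p = distinct d₁

      σ₀w : map σ₀ w ≡ p
      σ₀w = R₀.partner-a

      σ₀p : map σ₀ p ≡ w
      σ₀p = R₀.partner-b

      w≢q : ∀ {u} → p ≢ u → w ≢ map σ₀ u
      w≢q p≢u eq = p≢u (trans (≡-sym σ₀w) (trans (cong (map σ₀) eq) (involutive σ₀ _)))

      p≢q : ∀ {u} → w ≢ u → p ≢ map σ₀ u
      p≢q w≢u eq = w≢u (trans (≡-sym σ₀p) (trans (cong (map σ₀) eq) (involutive σ₀ _)))

      -- The second rewiring keeps this pair: if `w` or `p` were the `σ₀`-partner of `u₁` or `u₂`,
      -- that vertex would be `p` or `w`.
      τw : map τ w ≡ p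
      τw = trans (R.partner-off (w≢q p≢u₁) (w≢q p≢u₂)
        (p≢q w≢u₁ ∘ trans (≡-sym σ₀w)) (p≢q w≢u₂ ∘ trans (≡-sym σ₀w))) σ₀w

      σ₀≡σ : ∀ {t} → t ≢ w → t ≢ p → map σ t ≢ w → map σ t ≢ p → map σ₀ t ≡ map σ t
      σ₀≡σ = R₀.partner-off

      unchanged : ∀ {t} → Clear t → Clear (map σ t) → map τ t ≡ map σ t
      unchanged {t} (t≢u₁ , t≢u₂ , t≢w , t≢p) (s≢u₁ , s≢u₂ , s≢w , s≢p) =
        trans (R.partner-off {t} (λ eq → s≢u₁ (trans (≡-sym eq₀) (≡-sym (flip σ₀ (≡-sym eq)))))
                             (λ eq → s≢u₂ (trans (≡-sym eq₀) (≡-sym (flip σ₀ (≡-sym eq)))))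
                             (t≢u₁ ∘ injective σ₀) (t≢u₂ ∘ injective σ₀)) eq₀
        where eq₀ = σ₀≡σ t≢w t≢p s≢w s≢p

    solve : (∀ τ → Solvable W₀ τ) → Solvable W σ
    solve smaller = go
      (mono⊎free {c = c} W₀? w (drop w≢u₂ (edge-sym (to-a d₁)) (edge-sym (to-a d₂))))
      (mono⊎free {c = c} W₀? p (drop p≢u₂ (edge-sym (to-b d₁)) (edge-sym (to-b d₂))))
      where
      c : V → V → Bool
      c = proj₁ (smaller τ)

      lin : Linear W₀ c
      lin = proj₁ (proj₂ (smaller τ))

      prs : Pairs W₀ c τ
      prs = proj₂ (proj₂ (smaller τ))

      drop : ∀ {x} → x ≢ u₂ → Edge W x u₁ → Edge W x u₂ → AtMost 2 (Edge W₀ x)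
      drop {x} x≢u₂ e₁ e₂ = degree-drop 2 (degree-drop 3 (degree≤4 W x) e₂) (edge-without e₁ x≢u₂ u₁≢u₂)

      -- Exchanging the roles of `u₁` and `u₂` reverses the order of deletion, which gives an
      -- equivalent but not identical predicate.
      W₀′ : V → Set
      W₀′ = W ∖ u₁ ∖ u₂

      to : ∀ {x} → W₀ x → W₀′ x
      to ((w , p) , q) = (w , q) , p

      from : ∀ {x} → W₀′ x → W₀ x
      from ((w , p) , q) = (w , q) , p

      one-lone : ¬ Mono W₀ c q₁ ⊎ ¬ Mono W₀ c q₂
      one-lone with mono? W₀? c q₁
      ... | no ¬m = inj₁ ¬m
      ... | yes m = inj₂ λ m′ → prs q₁ (λ eq → u₁≢u₂ (injective σ₀ (trans (≡-sym eq) R.partner-a)))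
              (m , subst (Mono W₀ c) (≡-sym R.partner-a) m′)

      -- The partners `w` and `p` are exempt, being bichromatic at the end; for all others `σ₀`
      -- agrees with `σ` at `u`.
      lone : ∀ {u} → u ≢ w → u ≢ p → ¬ Mono W₀ c (map σ₀ u) → map σ u ≢ w → map σ u ≢ p → ¬ Mono W₀ c (map σ u)
      lone u≢w u≢p ¬m σu≢w σu≢p m = ¬m (subst (Mono W₀ c) (≡-sym (σ₀≡σ u≢w u≢p σu≢w σu≢p)) m)

      back : ∀ {v} → Mono W₀′ c v → Mono W₀ c v
      back = mono-transfer (λ e → edge-⊆ from e , refl) (edge-⊆ to)

      lin′ : Linear W₀′ c
      lin′ = linear-⊆ from lin

      prs′ : Pairs W₀′ c τ
      prs′ v τv≢v (m , m′) = prs v τv≢v (back m , back m′)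

      coloured-from : ∀ {k x y} → Coloured W₀′ c k x y → Coloured W₀ c k x y
      coloured-from (e , eq) = edge-⊆ from e , eq

      sat-to : ∀ {x β} → Saturated W₀ c x β → Saturated W₀′ c x β
      sat-to ((a , e , eq) , none) = (a , edge-⊆ to e , eq) , atMost-⊆ 0 coloured-from none

      go : Mono W₀ c w × ∃ (Saturated W₀ c w) ⊎ ¬ Mono W₀ c w × (∀ k → AtMost 1 (Coloured W₀ c k w)) →
           Mono W₀ c p × ∃ (Saturated W₀ c p) ⊎ ¬ Mono W₀ c p × (∀ k → AtMost 1 (Coloured W₀ c k p)) →
           Solvable W σ
      go (inj₁ (mw , _)) (inj₁ (mp , _)) =
        ⊥-elim (prs w (λ eq → w≢p (trans (≡-sym eq) τw)) (mw , subst (Mono W₀ c) (≡-sym τw) mp))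
      -- The 4-cycle through `w`, `u₁`, `p`, `u₂` is coloured alternately, so each of its vertices
      -- sees both colours.
      go (inj₂ (_ , free-w)) (inj₂ (_ , free-p)) = Twins.Build.solution σ u₁≢u₂ d₁ d₂ c lin τ prs unchanged
        true false false true (λ ()) (free-w true) (free-w false)
        (inj₁ ((λ ()) , free-p false , free-p true)) (inj₁ λ ()) (λ ()) λ ()
      go (inj₂ (_ , free-w)) (inj₁ (_ , β , sat)) with one-lone
      ... | inj₁ ¬m = twins-forced σ u₁≢u₂ d₁ d₂ c lin τ prs unchanged free-w sat
              (lone (≢-sym w≢u₁) (≢-sym p≢u₁) ¬m)
      ... | inj₂ ¬m = twins-forced σ (≢-sym u₁≢u₂) d₂ d₁ c lin′ τ prs′
              (λ (a , b , r) (a′ , b′ , r′) → unchanged (b , a , r) (b′ , a′ , r′))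
              (λ k → atMost-⊆ 1 coloured-from (free-w k)) (sat-to sat)
              λ nw np m → lone (≢-sym w≢u₂) (≢-sym p≢u₂) ¬m nw np (back m)
      go (inj₁ (_ , β , sat)) (inj₂ (_ , free-p)) with one-lone
      ... | inj₁ ¬m = twins-forced σ u₁≢u₂ (degree2-swap d₁) (degree2-swap d₂) c lin τ prs
              (λ (a , b , d , e) (a′ , b′ , d′ , e′) → unchanged (a , b , e , d) (a′ , b′ , e′ , d′)) free-p sat
              λ np nw → lone (≢-sym w≢u₁) (≢-sym p≢u₁) ¬m nw np
      ... | inj₂ ¬m = twins-forced σ (≢-sym u₁≢u₂) (degree2-swap d₂) (degree2-swap d₁) c lin′ τ prs′
              (λ (a , b , d , e) (a′ , b′ , d′ , e′) → unchanged (b , a , e , d) (b′ , a′ , e′ , d′))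
              (λ k → atMost-⊆ 1 coloured-from (free-p k)) (sat-to sat)
              λ np nw m → lone (≢-sym w≢u₂) (≢-sym p≢u₂) ¬m nw np (back m)

  -- A vertex with one triangle and one further edge.

  -- Opposite colours on the two edges of `u` make it bichromatic, and `w` has three edges. No
  -- inserted vertex is monochromatic, so `σ` is kept as it is.
  module Triangle {W : V → Set} (W? : ∀ x → Dec (W x)) (σ : Involution V) {u w p z : V}
    (du : Degree2 W u w p) (wp : Edge W w p) (wz : Edge W w z) (z≢p : z ≢ p) (z≢u : z ≢ u)
    (only-w : ∀ y → Edge W w y → y ≡ p ⊎ y ≡ u ⊎ y ≡ z) where

    W₀ : V → Set
    W₀ = W ∖ u ∖ w

    w≢u : w ≢ u
    w≢u = edge-≢ (edge-sym (to-a du))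

    p≢u : p ≢ u
    p≢u = edge-≢ (edge-sym (to-b du))

    p≢w : p ≢ w
    p≢w = edge-≢ (edge-sym wp)

    z≢w : z ≢ w
    z≢w = edge-≢ (edge-sym wz)

    dw : Degree2 (W ∖ u) w p z
    dw = record
      { distinct = ≢-sym z≢p ; to-a = edge-without wp w≢u p≢u ; to-b = edge-without wz w≢u z≢u
      ; only = λ y e → Sum.map₂ [ (λ y≡u → ⊥-elim (proj₂ (right e) y≡u)) , id ] (only-w y (edge-⊆ proj₁ e)) }

    -- `κ` and `α` colour the edges from `w` to `p` and `z`; `not μ` and `μ` those from `u` to `w`
    -- and `p`. The last hypothesis keeps `not μ` off one of the first two edges, leaving room for
    -- `u` at `w`. If `p` is free, `κ` and `μ` differ; if it is saturated, both are the missing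
    -- colour.
    module Build (c : V → V → Bool) (lin : Linear W₀ c) (prs : Pairs W₀ c σ) (κ μ α : Bool)
      (port : Port W₀ c p κ μ) (room-z : AtMost 1 (Coloured W₀ c α z)) (pendant : Pendant W₀ c z α)
      (κ≢α⊎κ≡μ : (κ ≢ α × μ ≡ α) ⊎ κ ≡ μ) where

      private
        module S₁ = Extend₂ (W ∖ u) w p z dw c κ α
        module S₂ = Extend₂ W u w p du S₁.c′ (not μ) μ

      c₂ : V → V → Bool
      c₂ = S₂.c′

      break : (κ ≢ α × μ ≡ α) ⊎ κ ≡ μ → Port W₀ c p κ μ →
              κ ≢ α ⊎ AtMost 0 (Coloured W₀ c κ p) ⊎ AtMost 0 (Coloured W₀ c α z)
      break (inj₁ (κ≢α , _)) _               = inj₁ κ≢α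
      break (inj₂ κ≡μ) (inj₁ (κ≢μ , _))      = ⊥-elim (κ≢μ κ≡μ)
      break (inj₂ _)   (inj₂ (_ , none , _)) = inj₂ (inj₁ none)

      room-w : (κ ≢ α × μ ≡ α) ⊎ κ ≡ μ → AtMost 1 (Coloured (W ∖ u) S₁.c′ (not μ) w)
      room-w (inj₁ (_ , refl)) = S₁.new-a (not-≢ μ)
      room-w (inj₂ refl)       = S₁.new-b (not-≢ μ)

      room-p : Port W₀ c p κ μ → AtMost 1 (Coloured (W ∖ u) S₁.c′ μ p)
      room-p (inj₁ (κ≢μ , _ , room)) = S₁.keep-a 1 κ≢μ room
      room-p (inj₂ (refl , none , _)) = S₁.grow 0 p≢w none

      lin₂ : Linear W c₂
      lin₂ = S₂.extend₂ (S₁.extend₂ lin (port-room {c = c} port) room-z (break κ≢α⊎κ≡μ port)) (room-w κ≢α⊎κ≡μ) (room-p port)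
        (inj₁ (≢-sym (not-≢ μ)))

      agree : ∀ {s t} → W₀ s → W₀ t → c₂ s t ≡ c s t
      agree ((_ , s≢u) , s≢w) ((_ , t≢u) , t≢w) = trans (S₂.off-z s≢u t≢u) (S₁.off-z s≢w t≢w)

      lift : ∀ {s t} → Edge W₀ s t → Edge W s t × c₂ s t ≡ c s t
      lift e = edge-⊆ (proj₁ ∘ proj₁) e , agree (left e) (right e)

      p-¬mono : ¬ Mono W c₂ p
      p-¬mono = port-¬mono {c₀ = c} port lift (edge-sym wp) (trans (S₂.off-z p≢u w≢u) S₁.at-a)
        (edge-sym (to-b du)) S₂.at-b

      z-¬mono : ¬ Mono W c₂ z
      z-¬mono = pendant-¬mono {c₀ = c} pendant (edge-sym wz) (trans (S₂.off-z z≢u w≢u) S₁.at-b) split lift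
        where
        split : ∀ {y} → Edge W z y → y ≡ w ⊎ Edge W₀ z y
        split {y} e with y ≟ w | y ≟ u
        ... | yes y≡w | _ = inj₁ y≡w
        ... | no y≢w | no y≢u = inj₂ (edge-without (edge-without e z≢u y≢u) z≢w y≢w)
        ... | no _ | yes refl = ⊥-elim ([ z≢w , z≢p ] (only du z (edge-sym e)))

      w-¬mono : (κ ≢ α × μ ≡ α) ⊎ κ ≡ μ → ¬ Mono W c₂ w
      w-¬mono (inj₁ (κ≢α , _)) = bichromatic wp wz λ eq → κ≢α
              (trans (≡-sym (trans (S₂.off-z w≢u p≢u) S₁.from-a)) (trans eq (trans (S₂.off-z w≢u z≢u) S₁.from-b)))
      w-¬mono (inj₂ κ≡μ) = bichromatic wp (edge-sym (to-a du)) λ eq → not-≢ μ (trans (≡-sym κ≡μ)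
              (trans (≡-sym (trans (S₂.off-z w≢u p≢u) S₁.from-a)) (trans eq S₂.at-a)))

      u-¬mono : ¬ Mono W c₂ u
      u-¬mono = bichromatic (to-b du) (to-a du) λ eq → not-≢ μ (trans (≡-sym S₂.from-b) (trans eq S₂.from-a))

      Z : V → Set
      Z t = t ≡ w ⊎ t ≡ u

      Z-¬mono : ∀ {t} → Z t → ¬ Mono W c₂ t
      Z-¬mono (inj₁ refl) = w-¬mono κ≢α⊎κ≡μ
      Z-¬mono (inj₂ refl) = u-¬mono

      touched : ∀ {s t} → Z t → Edge W s t → ¬ Z s → ¬ Mono W c₂ s
      touched (inj₁ refl) e ¬Z with only-w _ (edge-sym e)
      ... | inj₁ refl = p-¬mono
      ... | inj₂ (inj₁ refl) = ⊥-elim (¬Z (inj₂ refl))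
      ... | inj₂ (inj₂ refl) = z-¬mono
      touched (inj₂ refl) e ¬Z with only du _ (edge-sym e)
      ... | inj₁ refl = ⊥-elim (¬Z (inj₁ refl))
      ... | inj₂ refl = p-¬mono

      private
        module F = Finish {W} {W₀} {Z} {c₂} {c} (λ t → (t ≟ w) ⊎-dec (t ≟ u))
          (λ w ¬Z → (w , ¬Z ∘ inj₂) , ¬Z ∘ inj₁) (proj₁ ∘ proj₁) agree touched

      solution : Solvable W σ
      solution = c₂ , lin₂ , F.pairs σ σ (λ Zt m → ⊥-elim (Z-¬mono Zt m)) (λ _ _ _ _ → refl) prs

    solve : Solvable W₀ σ → Solvable W σ
    solve (c , lin , prs) with pendant-colour {c = c} W₀? z few-z | mono⊎free {c = c} W₀? p few-p
      where
      W₀? : ∀ x → Dec (W₀ x)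
      W₀? = remove? (remove? W? u) w

      few-z : AtMost 3 (Edge W₀ z)
      few-z = atMost-⊆ 3 (λ e → edge-⊆ (proj₁ ∘ proj₁) e , proj₂ (right e)) (degree≤4 W z w (edge-sym wz))

      few-p : AtMost 2 (Edge W₀ p)
      few-p = degree-drop 2 (degree-drop 3 (degree≤4 W p) (edge-sym (to-b du))) (edge-sym (to-a dw))
    ... | α , room-z , pendant | inj₂ (_ , free) = Build.solution c lin prs (not α) α α
            (inj₁ (≢-sym (not-≢ α) , free _ , free _)) room-z pendant (inj₁ (≢-sym (not-≢ α) , refl))
    ... | α , room-z , pendant | inj₁ (_ , β , sat) = Build.solution c lin prs (not β) (not β) α
            (saturated-port {c = c} sat) room-z pendant (inj₂ refl)

  -- A vertex with two triangles.

  module Fan {W : V → Set} (σ : Involution V) {u₁ u₂ w p q : V}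
    (d₁ : Degree2 W u₁ w p) (d₂ : Degree2 W u₂ w q) (wp : Edge W w p) (wq : Edge W w q)
    (p≢q : p ≢ q) (u₁≢u₂ : u₁ ≢ u₂) (p≢u₂ : p ≢ u₂) (q≢u₁ : q ≢ u₁)
    (only-w : ∀ y → Edge W w y → (y ≡ p ⊎ y ≡ u₁) ⊎ (y ≡ q ⊎ y ≡ u₂)) where

    W₀ : V → Set
    W₀ = W ∖ u₂ ∖ u₁ ∖ w

    w≢u₁ : w ≢ u₁
    w≢u₁ = edge-≢ (edge-sym (to-a d₁))

    w≢u₂ : w ≢ u₂
    w≢u₂ = edge-≢ (edge-sym (to-a d₂))

    p≢u₁ : p ≢ u₁
    p≢u₁ = edge-≢ (edge-sym (to-b d₁))

    q≢u₂ : q ≢ u₂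
    q≢u₂ = edge-≢ (edge-sym (to-b d₂))

    p≢w : p ≢ w
    p≢w = edge-≢ (edge-sym wp)

    q≢w : q ≢ w
    q≢w = edge-≢ (edge-sym wq)

    dw : Degree2 (W ∖ u₂ ∖ u₁) w p q
    dw = record
      { distinct = p≢q
      ; to-a = edge-without (edge-without wp w≢u₂ p≢u₂) w≢u₁ p≢u₁
      ; to-b = edge-without (edge-without wq w≢u₂ q≢u₂) w≢u₁ q≢u₁
      ; only = λ y e → Sum.map [ id , (λ y≡u₁ → ⊥-elim (proj₂ (right e) y≡u₁)) ]
                               [ id , (λ y≡u₂ → ⊥-elim (proj₂ (proj₁ (right e)) y≡u₂)) ]
                               (only-w y (edge-⊆ (proj₁ ∘ proj₁) e)) }

    Clear : V → Set
    Clear t = t ≢ u₁ × t ≢ u₂ × t ≢ p × t ≢ q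

    -- `a`, `b` colour the edges from `w` to `p`, `q`; `s`, `t` those from `u₁` to `w`, `p`; `s′`,
    -- `t′` those from `u₂` to `w`, `q`. By `balanced` each colour occurs exactly twice at `w`.
    module Build (c : V → V → Bool) (lin : Linear W₀ c) (τ : Involution V) (prs : Pairs W₀ c τ)
      (unchanged : ∀ {t} → Clear t → Clear (map σ t) → map τ t ≡ map σ t)
      (a b s t s′ t′ : Bool) (port-p : Port W₀ c p a t) (port-q : Port W₀ c q b t′)
      (break : a ≢ b ⊎ AtMost 0 (Coloured W₀ c a p) ⊎ AtMost 0 (Coloured W₀ c b q))
      (balanced : (a ≢ b × s ≢ s′) ⊎ (a ≢ s × b ≢ s × s ≡ s′))
      (s≡t⇒a,b≢s : s ≡ t → a ≢ s × b ≢ s) (s′≢t′ : s′ ≢ t′)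
      (u₁-lone : s ≡ t → map σ u₁ ≢ p → map σ u₁ ≢ q → ¬ Mono W₀ c (map σ u₁)) where

      private
        module S₁ = Extend₂ (W ∖ u₂ ∖ u₁) w p q dw c a b
        module S₂ = Extend₂ (W ∖ u₂) u₁ w p (degree2-without d₁ u₁≢u₂ w≢u₂ p≢u₂) S₁.c′ s t
      private
        module S₃ = Extend₂ W u₂ w q d₂ S₂.c′ s′ t′

      c₃ : V → V → Bool
      c₃ = S₃.c′

      room-p : Port W₀ c p a t → AtMost 1 (Coloured (W ∖ u₂ ∖ u₁) S₁.c′ t p)
      room-p (inj₁ (a≢t , _ , room)) = S₁.keep-a 1 a≢t room
      room-p (inj₂ (refl , none , _)) = S₁.grow 0 p≢w none

      room-q : Port W₀ c q b t′ → AtMost 1 (Coloured (W ∖ u₂ ∖ u₁) S₁.c′ t′ q)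
      room-q (inj₁ (b≢t′ , _ , room)) = S₁.keep-b 1 b≢t′ room
      room-q (inj₂ (refl , none , _)) = S₁.grow 0 q≢w none

      room-w : ∀ k → a ≢ b → AtMost 1 (Coloured (W ∖ u₂ ∖ u₁) S₁.c′ k w)
      room-w k a≢b with a ≟ᵇ k
      ... | no a≢k = S₁.new-b a≢k
      ... | yes refl = S₁.new-a (≢-sym a≢b)

      room-w₁ : (a ≢ b × s ≢ s′) ⊎ (a ≢ s × b ≢ s × s ≡ s′) →
                AtMost 1 (Coloured (W ∖ u₂ ∖ u₁) S₁.c′ s w)
      room-w₁ (inj₁ (a≢b , _))       = room-w s a≢b
      room-w₁ (inj₂ (a≢s , b≢s , _)) = atMost-suc 0 (S₁.new-none a≢s b≢s)

      room-w₂ : (a ≢ b × s ≢ s′) ⊎ (a ≢ s × b ≢ s × s ≡ s′) →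
                AtMost 1 (Coloured (W ∖ u₂) S₂.c′ s′ w)
      room-w₂ (inj₁ (a≢b , s≢s′))       = S₂.keep-a 1 s≢s′ (room-w s′ a≢b)
      room-w₂ (inj₂ (a≢s , b≢s , refl)) = S₂.grow 0 w≢u₁ (S₁.new-none a≢s b≢s)

      -- If `u₁` becomes monochromatic, its colour is new at `w`, since the edges to `p` and `q`
      -- both have the other one.
      break₂ : s ≢ t ⊎ AtMost 0 (Coloured (W ∖ u₂ ∖ u₁) S₁.c′ s w) ⊎ AtMost 0 (Coloured (W ∖ u₂ ∖ u₁) S₁.c′ t p)
      break₂ with s ≟ᵇ t
      ... | no s≢t = inj₁ s≢t
      ... | yes s≡t = inj₂ (inj₁ (S₁.new-none (proj₁ (s≡t⇒a,b≢s s≡t)) (proj₂ (s≡t⇒a,b≢s s≡t))))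

      lin₃ : Linear W c₃
      lin₃ = S₃.extend₂
        (S₂.extend₂ (S₁.extend₂ lin (port-room {c = c} port-p) (port-room {c = c} port-q) break)
          (room-w₁ balanced) (room-p port-p) break₂)
        (room-w₂ balanced) (S₂.keep-other 1 q≢u₁ q≢w (≢-sym p≢q) (room-q port-q)) (inj₁ s′≢t′)

      agree : ∀ {x y} → W₀ x → W₀ y → c₃ x y ≡ c x y
      agree (((_ , x≢u₂) , x≢u₁) , x≢w) (((_ , y≢u₂) , y≢u₁) , y≢w) =
        trans (S₃.off-z x≢u₂ y≢u₂) (trans (S₂.off-z x≢u₁ y≢u₁) (S₁.off-z x≢w y≢w))

      lift : ∀ {x y} → Edge W₀ x y → Edge W x y × c₃ x y ≡ c x y
      lift e = edge-⊆ (proj₁ ∘ proj₁ ∘ proj₁) e , agree (left e) (right e)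

      p-¬mono : ¬ Mono W c₃ p
      p-¬mono = port-¬mono {c₀ = c} port-p lift
        (edge-sym wp) (trans (S₃.off-z p≢u₂ w≢u₂) (trans (S₂.off-z p≢u₁ w≢u₁) S₁.at-a))
        (edge-sym (to-b d₁)) (trans (S₃.off-z p≢u₂ u₁≢u₂) S₂.at-b)

      q-¬mono : ¬ Mono W c₃ q
      q-¬mono = port-¬mono {c₀ = c} port-q lift
        (edge-sym wq) (trans (S₃.off-z q≢u₂ w≢u₂) (trans (S₂.off-z q≢u₁ w≢u₁) S₁.at-b))
        (edge-sym (to-b d₂)) S₃.at-b

      w-p : c₃ w p ≡ a
      w-p = trans (S₃.off-z w≢u₂ p≢u₂) (trans (S₂.off-z w≢u₁ p≢u₁) S₁.from-a)

      w-q : c₃ w q ≡ b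
      w-q = trans (S₃.off-z w≢u₂ q≢u₂) (trans (S₂.off-z w≢u₁ q≢u₁) S₁.from-b)

      w-u₁ : c₃ w u₁ ≡ s
      w-u₁ = trans (S₃.off-z w≢u₂ u₁≢u₂) S₂.at-a

      w-¬mono : (a ≢ b × s ≢ s′) ⊎ (a ≢ s × b ≢ s × s ≡ s′) → ¬ Mono W c₃ w
      w-¬mono (inj₁ (a≢b , _)) = bichromatic wp wq λ eq → a≢b (trans (≡-sym w-p) (trans eq w-q))
      w-¬mono (inj₂ (a≢s , _)) = bichromatic wp (edge-sym (to-a d₁)) λ eq →
        a≢s (trans (≡-sym w-p) (trans eq w-u₁))

      u₁-mono : Mono W c₃ u₁ → s ≡ t
      u₁-mono m = trans (≡-sym (trans (S₃.off-z u₁≢u₂ w≢u₂) S₂.from-a))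
        (trans (Mono.same m w p (to-a d₁) (to-b d₁)) (trans (S₃.off-z u₁≢u₂ p≢u₂) S₂.from-b))

      u₂-¬mono : ¬ Mono W c₃ u₂
      u₂-¬mono = bichromatic (to-a d₂) (to-b d₂)
        λ eq → s′≢t′ (trans (≡-sym S₃.from-a) (trans eq S₃.from-b))

      Z : V → Set
      Z x = x ≡ w ⊎ x ≡ u₁ ⊎ x ≡ u₂

      touched : ∀ {x z} → Z z → Edge W x z → ¬ Z x → ¬ Mono W c₃ x
      touched (inj₁ refl) e ¬Z with only-w _ (edge-sym e)
      ... | inj₁ (inj₁ refl) = p-¬mono
      ... | inj₂ (inj₁ refl) = q-¬mono
      ... | inj₁ (inj₂ refl) = ⊥-elim (¬Z (inj₂ (inj₁ refl)))
      ... | inj₂ (inj₂ refl) = u₂-¬mono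
      touched (inj₂ (inj₁ refl)) e _ with only d₁ _ (edge-sym e)
      ... | inj₁ refl = w-¬mono balanced
      ... | inj₂ refl = p-¬mono
      touched (inj₂ (inj₂ refl)) e _ with only d₂ _ (edge-sym e)
      ... | inj₁ refl = w-¬mono balanced
      ... | inj₂ refl = q-¬mono

      private
        module F = Finish {W} {W₀} {Z} {c₃} {c} (λ x → (x ≟ w) ⊎-dec (x ≟ u₁) ⊎-dec (x ≟ u₂))
          (λ w ¬Z → ((w , ¬Z ∘ inj₂ ∘ inj₂) , ¬Z ∘ inj₂ ∘ inj₁) , ¬Z ∘ inj₁) (proj₁ ∘ proj₁ ∘ proj₁) agree touched

      lone : ∀ {z} → Z z → Mono W c₃ z →
        (∀ {z′} → Z z′ → Mono W c₃ z′ → z′ ≡ z) × (¬ Z (map σ z) → ¬ Mono W c₃ (map σ z))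
      lone (inj₁ refl) m = ⊥-elim (w-¬mono balanced m)
      lone (inj₂ (inj₂ refl)) m = ⊥-elim (u₂-¬mono m)
      lone (inj₂ (inj₁ refl)) m =
        (λ { (inj₁ refl) m′ → ⊥-elim (w-¬mono balanced m′) ; (inj₂ (inj₁ eq)) _ → eq
           ; (inj₂ (inj₂ refl)) m′ → ⊥-elim (u₂-¬mono m′) }) ,
        λ ¬Z m′ → u₁-lone (u₁-mono m)
          (λ eq → p-¬mono (subst (Mono W c₃) eq m′)) (λ eq → q-¬mono (subst (Mono W c₃) eq m′)) (F.mono-old ¬Z m′)

      clear : ∀ {x} → ¬ Z x → Mono W c₃ x → Clear x
      clear ¬Z m = ¬Z ∘ inj₂ ∘ inj₁ , ¬Z ∘ inj₂ ∘ inj₂ , (λ { refl → p-¬mono m }) , λ { refl → q-¬mono m }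

      solution : Solvable W σ
      solution = c₃ , lin₃ , F.pairs σ τ lone (λ ¬Z ¬Z′ m m′ → unchanged (clear ¬Z m) (clear ¬Z′ m′)) prs

    -- This colouring makes u₁ monochromatic.
    half-forced : (c : V → V → Bool) → Linear W₀ c → (τ : Involution V) → Pairs W₀ c τ →
      (∀ {t} → Clear t → Clear (map σ t) → map τ t ≡ map σ t) →
      (∀ k → AtMost 1 (Coloured W₀ c k p)) → ∀ {β} → Saturated W₀ c q β →
      (map σ u₁ ≢ p → map σ u₁ ≢ q → ¬ Mono W₀ c (map σ u₁)) → Solvable W σ
    half-forced c lin τ prs unchanged free {β} sat lone =
      Build.solution c lin τ prs unchanged (not β) (not β) β β β (not β)
        (inj₁ (≢-sym (not-≢ β) , free _ , free _)) (saturated-port {c = c} sat) (inj₂ (inj₂ (proj₂ sat)))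
        (inj₂ (≢-sym (not-≢ β) , ≢-sym (not-≢ β) , refl))
        (λ _ → ≢-sym (not-≢ β) , ≢-sym (not-≢ β)) (not-≢ β) λ _ → lone

  -- The pairing links q with the partner of u₁ and p with the partner of u₂, because u₁ has to be
  -- monochromatic exactly if q is saturated and p is not, and symmetrically for u₂.
  module SolveFan {W : V → Set} (W? : ∀ x → Dec (W x)) (σ : Involution V) {u₁ u₂ w p q : V}
    (d₁ : Degree2 W u₁ w p) (d₂ : Degree2 W u₂ w q) (wp : Edge W w p) (wq : Edge W w q)
    (p≢q : p ≢ q) (u₁≢u₂ : u₁ ≢ u₂) (p≢u₂ : p ≢ u₂) (q≢u₁ : q ≢ u₁)
    (only-w : ∀ y → Edge W w y → (y ≡ p ⊎ y ≡ u₁) ⊎ (y ≡ q ⊎ y ≡ u₂)) where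

    open Fan σ d₁ d₂ wp wq p≢q u₁≢u₂ p≢u₂ q≢u₁ only-w
      using (W₀; Clear; w≢u₁; w≢u₂; p≢u₁; q≢u₂; p≢w; q≢w; dw; half-forced; module Build)

    private
      module R₀ = Rewire σ p q
      σ₀ = R₀.rewired
      v₁ = map σ₀ u₁
      v₂ = map σ₀ u₂
      module R₁ = Rewire σ₀ p v₂
      σ₁ = R₁.rewired
      module R₂ = Rewire σ₁ q v₁
      τ = R₂.rewired

      W₀? : ∀ x → Dec (W₀ x)
      W₀? = remove? (remove? (remove? W? u₂) u₁) w

      σ₀p : map σ₀ p ≡ q
      σ₀p = R₀.partner-a

      σ₀q : map σ₀ q ≡ p
      σ₀q = R₀.partner-b

      p≢v : ∀ {u} → q ≢ u → p ≢ map σ₀ u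
      p≢v q≢u eq = q≢u (trans (≡-sym σ₀p) (trans (cong (map σ₀) eq) (involutive σ₀ _)))

      q≢v : ∀ {u} → p ≢ u → q ≢ map σ₀ u
      q≢v p≢u eq = p≢u (trans (≡-sym σ₀q) (trans (cong (map σ₀) eq) (involutive σ₀ _)))

      v₁≢v₂ : v₁ ≢ v₂
      v₁≢v₂ = u₁≢u₂ ∘ injective σ₀

      τq : map τ q ≡ v₁
      τq = R₂.partner-a

      -- `σ₁` creates this pair, and the last rewiring spares it because `q` and `v₁` are both
      -- different from `p` and `v₂`.
      τp : map τ p ≡ v₂
      τp = trans (R₂.partner-off p≢q (p≢v q≢u₁) (λ eq → q≢v p≢u₂ (≡-sym (trans (≡-sym σ₁p) eq)))
                   (λ eq → v₁≢v₂ (≡-sym (trans (≡-sym σ₁p) eq)))) σ₁p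
        where
        σ₁p : map σ₁ p ≡ v₂
        σ₁p = R₁.partner-a

      σ₀≡σ : ∀ {t} → t ≢ p → t ≢ q → map σ t ≢ p → map σ t ≢ q → map σ₀ t ≡ map σ t
      σ₀≡σ = R₀.partner-off

      unchanged : ∀ {t} → Clear t → Clear (map σ t) → map τ t ≡ map σ t
      unchanged {t} (t≢u₁ , t≢u₂ , t≢p , t≢q) (s≢u₁ , s≢u₂ , s≢p , s≢q) = trans
        (R₂.partner-off {t} t≢q (t≢v s≢u₁) (s≢q ∘ trans (≡-sym eq₁))
          (t≢u₁ ∘ injective σ₀ ∘ trans (≡-sym eq₁′))) eq₁
        where
        eq₀ : map σ₀ t ≡ map σ t
        eq₀ = σ₀≡σ t≢p t≢q s≢p s≢q
        t≢v : ∀ {u} → map σ t ≢ u → t ≢ map σ₀ u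
        t≢v s≢u eq = s≢u (trans (≡-sym eq₀) (≡-sym (flip σ₀ (≡-sym eq))))
        eq₁′ : map σ₁ t ≡ map σ₀ t
        eq₁′ = R₁.partner-off {t} t≢p (t≢v s≢u₂) (s≢p ∘ trans (≡-sym eq₀)) (t≢u₂ ∘ injective σ₀)
        eq₁ : map σ₁ t ≡ map σ t
        eq₁ = trans eq₁′ eq₀

    solve : (∀ τ → Solvable W₀ τ) → Solvable W σ
    solve smaller = go
      (mono⊎free {c = c} W₀? p (atMost-⊆ 2 (λ e → edge-⊆ (λ (((w , _) , x) , y) → (w , x) , y) e)
        (degree-drop 2 (degree-drop 3 (degree≤4 W p) (edge-sym (to-b d₁))) (edge-without (edge-sym wp) p≢u₁ w≢u₁))))
      (mono⊎free {c = c} W₀? q (atMost-⊆ 2 (λ e → edge-⊆ (λ (((w , x) , _) , y) → (w , x) , y) e)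
        (degree-drop 2 (degree-drop 3 (degree≤4 W q) (edge-sym (to-b d₂))) (edge-without (edge-sym wq) q≢u₂ w≢u₂))))
      where
      c : V → V → Bool
      c = proj₁ (smaller τ)

      lin : Linear W₀ c
      lin = proj₁ (proj₂ (smaller τ))

      prs : Pairs W₀ c τ
      prs = proj₂ (proj₂ (smaller τ))

      W₀′ : V → Set
      W₀′ = W ∖ u₁ ∖ u₂ ∖ w

      to : ∀ {x} → W₀ x → W₀′ x
      to (((v , x) , y) , z) = ((v , y) , x) , z

      from : ∀ {x} → W₀′ x → W₀ x
      from (((v , x) , y) , z) = ((v , y) , x) , z

      back : ∀ {v} → Mono W₀′ c v → Mono W₀ c v
      back = mono-transfer (λ e → edge-⊆ from e , refl) (edge-⊆ to)

      lin′ : Linear W₀′ c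
      lin′ = linear-⊆ from lin

      prs′ : Pairs W₀′ c τ
      prs′ v τv≢v (m , m′) = prs v τv≢v (back m , back m′)

      coloured-from : ∀ {k x y} → Coloured W₀′ c k x y → Coloured W₀ c k x y
      coloured-from (e , eq) = edge-⊆ from e , eq

      lone : ∀ {u x} → u ≢ p → u ≢ q → Mono W₀ c x → map τ x ≢ x → map τ x ≡ map σ₀ u →
             map σ u ≢ p → map σ u ≢ q → ¬ Mono W₀ c (map σ u)
      lone u≢p u≢q mx τx≢x τx σu≢p σu≢q m =
        prs _ τx≢x (mx , subst (Mono W₀ c) (≡-sym (trans τx (σ₀≡σ u≢p u≢q σu≢p σu≢q))) m)

      go : Mono W₀ c p × ∃ (Saturated W₀ c p) ⊎ ¬ Mono W₀ c p × (∀ k → AtMost 1 (Coloured W₀ c k p)) →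
           Mono W₀ c q × ∃ (Saturated W₀ c q) ⊎ ¬ Mono W₀ c q × (∀ k → AtMost 1 (Coloured W₀ c k q)) →
           Solvable W σ
      go (inj₂ (_ , free-p)) (inj₂ (_ , free-q)) = Build.solution c lin τ prs unchanged
        true false true false false true
        (inj₁ ((λ ()) , free-p true , free-p false)) (inj₁ ((λ ()) , free-q false , free-q true))
        (inj₁ λ ()) (inj₁ ((λ ()) , λ ())) (λ ()) (λ ()) λ ()
      go (inj₂ (_ , free-p)) (inj₁ (mq , _ , sat)) = half-forced c lin τ prs unchanged free-p sat
        (lone (≢-sym p≢u₁) (≢-sym q≢u₁) mq (λ eq → q≢v p≢u₁ (trans (≡-sym eq) τq)) τq)
      go (inj₁ (mp , _ , sat)) (inj₂ (_ , free-q)) =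
        Fan.half-forced σ d₂ d₁ wq wp (≢-sym p≢q) (≢-sym u₁≢u₂) q≢u₁ p≢u₂ (λ y e → Sum.swap (only-w y e))
          c lin′ τ prs′ (λ (a , b , d , e) (a′ , b′ , d′ , e′) → unchanged (b , a , e , d) (b′ , a′ , e′ , d′))
          (λ k → atMost-⊆ 1 coloured-from (free-q k))
          (let ((a , e , eq) , none) = sat in (a , edge-⊆ to e , eq) , atMost-⊆ 0 coloured-from none)
          λ nq np m → lone (≢-sym p≢u₂) (≢-sym q≢u₂) mp (λ eq → p≢v q≢u₂ (trans (≡-sym eq) τp)) τp np nq (back m)
      -- Both new edges at `p`, and both at `q`, get the colour missing there. Giving the remaining
      -- edges of `u₁` and `u₂` the opposite colours makes these bichromatic and still leaves two
      -- edges of each colour at `w`.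
      go (inj₁ (_ , β , sat-p)) (inj₁ (_ , γ , sat-q)) with β ≟ᵇ γ
      ... | yes refl = Build.solution c lin τ prs unchanged (not β) (not β) β (not β) β (not β)
              (saturated-port {c = c} sat-p) (saturated-port {c = c} sat-q) (inj₂ (inj₁ (proj₂ sat-p)))
              (inj₂ (≢-sym (not-≢ β) , ≢-sym (not-≢ β) , refl))
              (λ _ → ≢-sym (not-≢ β) , ≢-sym (not-≢ β)) (not-≢ β) (λ eq → ⊥-elim (not-≢ β eq))
      ... | no β≢γ = Build.solution c lin τ prs unchanged (not β) (not γ) β (not β) γ (not γ)
              (saturated-port {c = c} sat-p) (saturated-port {c = c} sat-q) (inj₂ (inj₁ (proj₂ sat-p)))
              (inj₁ (β≢γ ∘ not-injective , β≢γ)) (λ eq → ⊥-elim (not-≢ β eq)) (not-≢ γ)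
              (λ eq → ⊥-elim (not-≢ β eq))

  -- Unavoidable configurations

  data Configuration (W : V → Set) : Set where
    low      : ∀ {v} → W v → AtMost 1 (Edge W v) → Configuration W
    adjacent : ∀ {u v x y} → Degree2 W u v x → Degree2 W v u y → Configuration W
    twins    : ∀ {u₁ u₂ w p} → u₁ ≢ u₂ → Degree2 W u₁ w p → Degree2 W u₂ w p → Configuration W
    triangle : ∀ {u w p z} → Degree2 W u w p → Edge W w p → Edge W w z → z ≢ p → z ≢ u →
               (∀ y → Edge W w y → y ≡ p ⊎ y ≡ u ⊎ y ≡ z) → Configuration W
    fan      : ∀ {u₁ u₂ w p q} → Degree2 W u₁ w p → Degree2 W u₂ w q → Edge W w p → Edge W w q →
               p ≢ q → u₁ ≢ u₂ → p ≢ u₂ → q ≢ u₁ →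
               (∀ y → Edge W w y → (y ≡ p ⊎ y ≡ u₁) ⊎ (y ≡ q ⊎ y ≡ u₂)) → Configuration W

  module Unavoidable (el : Elimination G) {W : V → Set} (W? : ∀ x → Dec (W x))
                     (dense : ∀ v → W v → AtLeast 2 (Edge W v)) where
    open Elimination el renaming (edge to later)

    Big : V → Set
    Big v = AtLeast 3 (Edge W v)

    classify : ∀ v → W v → Big v ⊎ (∃[ a ] ∃[ b ] Degree2 W v a b)
    classify v vW with atLeast⊎atMost (edge? W? v) 2 | dense v vW
    ... | inj₁ big | _ = inj₁ big
    ... | inj₂ few | a , va , b , (vb , b≢a) , _ = inj₂ (a , b , record
          { distinct = ≢-sym b≢a ; to-a = va ; to-b = vb ; only = atMost2-cases few (≢-sym b≢a) va vb })

    degree2-at : ∀ {v x} → W v → Edge W v x → Big v ⊎ (∃[ b ] Degree2 W v x b)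
    degree2-at {v} vW vx with classify v vW
    ... | inj₁ big = inj₁ big
    ... | inj₂ (a , b , d) with only d _ vx
    ... | inj₁ refl = inj₂ (b , d)
    ... | inj₂ refl = inj₂ (a , degree2-swap d)

    -- The vertex reached from w through its neighbour y, after suppressing vertices of degree 2.
    Reaches : V → V → V → Set
    Reaches w y x = (Big y × y ≡ x) ⊎ (Degree2 W y w x × Big x)

    reach : ∀ {w y} → Edge W w y → Configuration W ⊎ ∃ (Reaches w y)
    reach {w} {y} wy with degree2-at (right wy) (edge-sym wy)
    ... | inj₁ big = inj₂ (y , inj₁ (big , refl))
    ... | inj₂ (x , d) with degree2-at (right (to-b d)) (edge-sym (to-b d))
    ... | inj₁ big = inj₂ (x , inj₂ (d , big))
    ... | inj₂ (_ , d′) = inj₁ (adjacent (degree2-swap d) d′)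

    -- `k` stands for the target `x` in the later bag of `w`: it is `x` itself or the vertex of
    -- degree 2 in between.
    Through : V → V → V → Set
    Through w k x = (Big k × k ≡ x) ⊎ Degree2 W k w x

    through-unique : ∀ {w k x x′} → Through w k x → Through w k x′ → x ≡ x′
    through-unique (inj₁ (_ , refl)) (inj₁ (_ , refl)) = refl
    through-unique (inj₁ (big , _)) (inj₂ d) = ⊥-elim (atLeast-atMost-⊥ 2 big (degree2-atMost d))
    through-unique (inj₂ d) (inj₁ (big , _)) = ⊥-elim (atLeast-atMost-⊥ 2 big (degree2-atMost d))
    through-unique (inj₂ d) (inj₂ d′) with only d′ _ (to-b d)
    ... | inj₁ x≡w = ⊥-elim (distinct d (≡-sym x≡w))
    ... | inj₂ x≡x′ = x≡x′

    module At (w : V) (w-big : Big w) (w-first : ∀ y → Big y → rank w ≤ rank y) where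

      -- If the vertex `y` of degree 2 is eliminated no later than `w`, its elimination joins `w` to
      -- `x`; otherwise `y` itself is in the bag of `w`. Either way the bound on `Later w` limits
      -- the targets of `w`.
      key : ∀ {y x} → Edge W w y → Reaches w y x → ∃[ k ] (Later w ∖ w) k × Through w k x
      key {y} wy (inj₁ (big , refl)) =
        y , (later (Edge.adjacent wy) (w-first y big) , ≢-sym (edge-≢ wy)) , inj₁ (big , refl)
      key {y} {x} wy (inj₂ (d , big)) with ≤-total (rank y) (rank w)
      ... | inj₂ w≤y = y , (later (Edge.adjacent wy) w≤y , ≢-sym (edge-≢ wy)) , inj₂ d
      ... | inj₁ y≤w = x , (fill (later (Edge.adjacent (to-a d)) y≤w)
              (later (Edge.adjacent (to-b d)) (≤-trans y≤w (w-first x big))) (w-first x big) ,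
              ≢-sym (distinct d)) , inj₁ (big , refl)

      -- A key determines its target, so three targets would put three elements besides `w` into
      -- `Later w`.
      two-targets : ∀ {y₁ y₂ y₃ x₁ x₂ x₃} → Edge W w y₁ → Edge W w y₂ → Edge W w y₃ →
                    Reaches w y₁ x₁ → Reaches w y₂ x₂ → Reaches w y₃ x₃ →
                    x₁ ≢ x₂ → x₁ ≢ x₃ → x₂ ≢ x₃ → ⊥
      two-targets e₁ e₂ e₃ r₁ r₂ r₃ x₁≢x₂ x₁≢x₃ x₂≢x₃ with key e₁ r₁ | key e₂ r₂ | key e₃ r₃
      ... | k₁ , l₁ , t₁ | k₂ , l₂ , t₂ | k₃ , l₃ , t₃ =
        few w k₁ l₁ k₂ (l₂ , apart x₁≢x₂ t₁ t₂) k₃ ((l₃ , apart x₁≢x₃ t₁ t₃) , apart x₂≢x₃ t₂ t₃)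
        where
        apart : ∀ {k k′ x x′} → x ≢ x′ → Through w k x → Through w k′ x′ → k′ ≢ k
        apart x≢x′ t t′ refl = x≢x′ (through-unique t t′)

      data Triangle-on (y y′ : V) : Set where
        first  : Degree2 W y w y′ → Big y′ → Triangle-on y y′
        second : Degree2 W y′ w y → Big y → Triangle-on y y′

      same-target : ∀ {y y′ x} → y ≢ y′ → Reaches w y x → Reaches w y′ x →
                    Configuration W ⊎ Triangle-on y y′
      same-target y≢y′ (inj₁ (_ , refl)) (inj₁ (_ , refl)) = ⊥-elim (y≢y′ refl)
      same-target y≢y′ (inj₁ (big , refl)) (inj₂ (d , _)) = inj₂ (second d big)
      same-target y≢y′ (inj₂ (d , _)) (inj₁ (big , refl)) = inj₂ (first d big)
      same-target y≢y′ (inj₂ (d , _)) (inj₂ (d′ , _)) = inj₁ (twins y≢y′ d d′)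

      -- At most two edges of `w` lie outside the triangle. If there are two, neither leads to `p`
      -- unless there are twins; as `p` is already a target, both lead to the same other one, which
      -- gives twins again or a second triangle.
      from-triangle : ∀ {u p} → Degree2 W u w p → Edge W w p → Big p → Configuration W
      from-triangle {u} {p} d wp p-big = go (atLeast⊎atMost Rest? 1) (atLeast⊎atMost Rest? 0)
        where
        Rest : V → Set
        Rest = Edge W w ∖ p ∖ u

        Rest? : ∀ x → Dec (Rest x)
        Rest? = remove? (remove? (edge? W? w) p) u

        wu : Edge W w u
        wu = edge-sym (to-a d)

        u≢p : u ≢ p
        u≢p = edge-≢ (to-b d)

        split : ∀ y → Edge W w y → (y ≡ p ⊎ y ≡ u) ⊎ Rest y
        split y e with y ≟ p | y ≟ u
        ... | yes y≡p | _ = inj₁ (inj₁ y≡p)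
        ... | no _ | yes y≡u = inj₁ (inj₂ y≡u)
        ... | no y≢p | no y≢u = inj₂ ((e , y≢p) , y≢u)

        rest≤2 : AtMost 2 Rest
        rest≤2 = degree≤4 W w p wp u (wu , u≢p)

        with-fan : ∀ {q v} → Rest q → Rest v → q ≢ v → Degree2 W v w q → Configuration W
        with-fan rq@((wq , q≢p) , q≢u) rv@((wv , v≢p) , v≢u) q≢v d′ =
          fan d d′ wp wq (≢-sym q≢p) (≢-sym v≢u) (≢-sym v≢p) q≢u λ y e →
            [ inj₁ , (λ ry → inj₂ (atMost2-cases rest≤2 q≢v rq rv y ry)) ] (split y e)

        with-two : ∀ {z z′} → Rest z → Rest z′ → z ≢ z′ → Configuration W
        with-two {z} {z′} rz@((wz , z≢p) , z≢u) rz′@((wz′ , z′≢p) , z′≢u) z≢z′ with reach wz | reach wz′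
        ... | inj₁ conf | _ = conf
        ... | inj₂ _ | inj₁ conf = conf
        ... | inj₂ (x , r) | inj₂ (x′ , r′) with p ≟ x | p ≟ x′ | x ≟ x′
        with-two rz@((wz , z≢p) , z≢u) _ _ | inj₂ (x , inj₁ (_ , refl)) | inj₂ _ | yes p≡x | _ | _ =
          ⊥-elim (z≢p (≡-sym p≡x))
        with-two rz@((wz , z≢p) , z≢u) _ _ | inj₂ (x , inj₂ (d′ , _)) | inj₂ _ | yes refl | _ | _ =
          twins z≢u d′ d
        with-two _ rz@((wz , z≢p) , z≢u) _ | inj₂ _ | inj₂ (x , inj₁ (_ , refl)) | no _ | yes p≡x | _ =
          ⊥-elim (z≢p (≡-sym p≡x))
        with-two _ rz@((wz , z≢p) , z≢u) _ | inj₂ _ | inj₂ (x , inj₂ (d′ , _)) | no _ | yes refl | _ =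
          twins z≢u d′ d
        with-two ((wz , _) , _) ((wz′ , _) , _) _ | inj₂ (x , r) | inj₂ (x′ , r′) | no p≢x | no p≢x′ | no x≢x′ =
          ⊥-elim (two-targets wp wz wz′ (inj₁ (p-big , refl)) r r′ p≢x p≢x′ x≢x′)
        with-two {z} {z′} rz rz′ z≢z′ | inj₂ (x , r) | inj₂ (x′ , r′) | no _ | no _ | yes refl
          with same-target z≢z′ r r′
        ... | inj₁ conf = conf
        ... | inj₂ (first d′ _)  = with-fan rz′ rz (≢-sym z≢z′) d′
        ... | inj₂ (second d′ _) = with-fan rz rz′ z≢z′ d′

        go : AtLeast 2 Rest ⊎ AtMost 1 Rest → AtLeast 1 Rest ⊎ AtMost 0 Rest → Configuration W
        go (inj₁ (z , rz , z′ , (rz′ , z′≢z) , _)) _ = with-two rz rz′ (≢-sym z′≢z)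
        go (inj₂ _) (inj₂ none) = ⊥-elim (atLeast-atMost-⊥ 2 w-big (atMost-insert 1 p (atMost-insert 0 u none)))
        go (inj₂ one) (inj₁ (z , rz@((wz , z≢p) , z≢u) , _)) = triangle d wp wz z≢p z≢u only-z
          where
          only-z : ∀ y → Edge W w y → y ≡ p ⊎ y ≡ u ⊎ y ≡ z
          only-z y e with split y e | y ≟ z
          ... | inj₁ (inj₁ y≡p) | _ = inj₁ y≡p
          ... | inj₁ (inj₂ y≡u) | _ = inj₂ (inj₁ y≡u)
          ... | inj₂ _ | yes y≡z = inj₂ (inj₂ y≡z)
          ... | inj₂ ry | no y≢z = ⊥-elim (one z rz y (ry , y≢z))

      from-triangle-on : ∀ {y y′} → Edge W w y → Edge W w y′ → Triangle-on y y′ → Configuration W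
      from-triangle-on wy wy′ (first d big)  = from-triangle d wy′ big
      from-triangle-on wy wy′ (second d big) = from-triangle d wy big

      coincide : ∀ {y y′ x} → Edge W w y → Edge W w y′ → y ≢ y′ → Reaches w y x → Reaches w y′ x →
                 Configuration W
      coincide wy wy′ y≢y′ r r′ = [ id , from-triangle-on wy wy′ ] (same-target y≢y′ r r′)

      configuration : Big w → Configuration W
      configuration (y₁ , e₁ , y₂ , (e₂ , y₂≢y₁) , y₃ , ((e₃ , y₃≢y₁) , y₃≢y₂) , _)
        with reach e₁ | reach e₂ | reach e₃
      ... | inj₁ conf | _ | _ = conf
      ... | inj₂ _ | inj₁ conf | _ = conf
      ... | inj₂ _ | inj₂ _ | inj₁ conf = conf
      ... | inj₂ (x₁ , r₁) | inj₂ (x₂ , r₂) | inj₂ (x₃ , r₃) with x₁ ≟ x₂ | x₁ ≟ x₃ | x₂ ≟ x₃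
      ... | yes refl | _ | _ = coincide e₁ e₂ (≢-sym y₂≢y₁) r₁ r₂
      ... | no _ | yes refl | _ = coincide e₁ e₃ (≢-sym y₃≢y₁) r₁ r₃
      ... | no _ | no _ | yes refl = coincide e₂ e₃ (≢-sym y₃≢y₂) r₂ r₃
      ... | no p | no q | no r = ⊥-elim (two-targets e₁ e₂ e₃ r₁ r₂ r₃ p q r)

    configuration : ∃ W → Configuration W
    configuration (v , vW) with some-big
      where
      some-big : Configuration W ⊎ ∃ Big
      some-big with classify v vW
      ... | inj₁ big = inj₂ (v , big)
      ... | inj₂ (a , b , d) with degree2-at (right (to-a d)) (edge-sym (to-a d))
      ... | inj₁ big = inj₂ (a , big)
      ... | inj₂ (_ , d′) = inj₁ (adjacent d d′)
    ... | inj₁ conf = conf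
    ... | inj₂ big with extremal {_≼_ = λ x y → rank x ≤ rank y} ≤-refl ≤-trans
                          (λ x y → ≤-total (rank x) (rank y)) (n G) big? (atMost-N _) big
      where
      big? : ∀ x → Dec (Big x)
      big? x with atLeast⊎atMost (edge? W? x) 2
      ... | inj₁ many = yes many
      ... | inj₂ few′ = no λ many → atLeast-atMost-⊥ 2 many few′
    ... | w , w-big , w-first = At.configuration w w-big w-first w-big

  configuration : Elimination G → ∀ {W} → (∀ x → Dec (W x)) → ∃ W → Configuration W
  configuration el {W} W? nonempty with any? (λ v → W? v ×-dec atMost? (edge? W? v) 1)
  ... | yes (v , vW , few) = low vW few
  ... | no ∄ = Unavoidable.configuration el W? dense nonempty
    where
    dense : ∀ v → W v → AtLeast 2 (Edge W v)
    dense v vW with atLeast⊎atMost (edge? W? v) 1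
    ... | inj₁ many = many
    ... | inj₂ few  = ⊥-elim (∄ (v , vW , few))

  -- The induction on the vertex set.

  solvable-empty : ∀ {W} → AtMost 0 W → (σ : Involution V) → Solvable W σ
  solvable-empty none σ = (λ _ _ → true) ,
    record { symmetric = λ _ _ → refl ; degree≤2 = λ k v x e → ⊥-elim (none x (right (proj₁ e)))
           ; coreless = λ k S ((x , xS) , dense) → none x (left (proj₁ (proj₂ (proj₁ (proj₂ (dense x xS)))))) } ,
    λ v _ (m , _) → none v (left (proj₁ (proj₂ (Mono.many m))))

  -- `k` bounds the size of `W`. The involution is universally quantified because the re-pairing is
  -- known only once a configuration has been found.
  solvable : Elimination G → (k : ℕ) {W : V → Set} → (∀ x → Dec (W x)) → AtMost k W →
             (σ : Involution V) → Solvable W σ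
  solvable el zero W? none σ = solvable-empty none σ
  solvable el (suc k) W? few σ with any? W?
  ... | no ∄ = solvable-empty (λ x xW → ∄ (x , xW)) σ
  ... | yes nonempty with configuration el W? nonempty
  ... | low {v} vW one = add-low W? σ v vW one (solvable el k (remove? W? v) (few v vW) σ)
  ... | adjacent {u} {v} du dv = AdjacentTwos.solve W? σ du dv
          (solvable el k (remove? (remove? W? v) u) (atMost-⊆ k proj₁ (few v (left (to-a dv)))))
  ... | twins {u₁} {u₂} u₁≢u₂ d₁ d₂ = SolveTwins.solve W? σ u₁≢u₂ d₁ d₂
          (solvable el k (remove? (remove? W? u₂) u₁) (atMost-⊆ k proj₁ (few u₂ (left (to-a d₂)))))
  ... | triangle {u} {w} d wp wz z≢p z≢u only-w = Triangle.solve W? σ d wp wz z≢p z≢u only-w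
          (solvable el k (remove? (remove? W? u) w) (atMost-⊆ k proj₁ (few u (left (to-a d)))) σ)
  ... | fan {u₁} {u₂} {w} d₁ d₂ wp wq p≢q u₁≢u₂ p≢u₂ q≢u₁ only-w =
          SolveFan.solve W? σ d₁ d₂ wp wq p≢q u₁≢u₂ p≢u₂ q≢u₁ only-w
          (solvable el k (remove? (remove? (remove? W? u₂) u₁) w)
            (atMost-⊆ k (proj₁ ∘ proj₁) (few u₂ (left (to-a d₂)))))

-- From the sets of the theorem to an involution.

module Pairing {N m : ℕ} (S : Fin m → Fin 2 → Fin N) (distinct : ∀ i → S i zero ≢ S i (suc zero))
               (disjoint : ∀ i j a b → S i a ≡ S j b → i ≡ j) where

  other : Fin 2 → Fin 2
  other zero       = suc zero
  other (suc zero) = zero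

  other-involutive : ∀ a → other (other a) ≡ a
  other-involutive zero       = refl
  other-involutive (suc zero) = refl

  index-unique : ∀ {i j} a b → S i a ≡ S j b → i ≡ j × a ≡ b
  index-unique {i} {j} a b eq with disjoint i j a b eq
  index-unique zero       zero       eq | refl = refl , refl
  index-unique (suc zero) (suc zero) eq | refl = refl , refl
  index-unique zero       (suc zero) eq | refl = ⊥-elim (distinct _ eq)
  index-unique (suc zero) zero       eq | refl = ⊥-elim (distinct _ (≡-sym eq))

  Paired : Fin N → Set
  Paired v = ∃[ i ] ∃[ a ] v ≡ S i a

  paired? : ∀ v → Dec (Paired v)
  paired? v = any? (λ i → any? (λ a → v ≟ S i a))

  -- The decision is an argument so that the lemmas hold for whatever index the search returns;
  -- disjointness makes the result independent of it.
  mate : (v : Fin N) → Dec (Paired v) → Fin N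
  mate v (yes (i , a , _)) = S i (other a)
  mate v (no _)            = v

  mate-paired : ∀ i a (p? : Dec (Paired (S i a))) → mate (S i a) p? ≡ S i (other a)
  mate-paired i a (no ¬p) = ⊥-elim (¬p (i , a , refl))
  mate-paired i a (yes (j , b , eq)) with index-unique a b eq
  ... | refl , refl = refl

  mate-unpaired : ∀ {v} → ¬ Paired v → (p? : Dec (Paired v)) → mate v p? ≡ v
  mate-unpaired ¬p (yes p) = ⊥-elim (¬p p)
  mate-unpaired ¬p (no _)  = refl

  mate-mate : ∀ v (p? : Dec (Paired v)) → mate (mate v p?) (paired? (mate v p?)) ≡ v
  mate-mate v (yes (i , a , refl)) = trans (mate-paired i (other a) (paired? _)) (cong (S i) (other-involutive a))
  mate-mate v (no ¬p) = mate-unpaired ¬p (paired? v)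

  pairing : Involution (Fin N)
  pairing = record { map = λ v → mate v (paired? v) ; involutive = λ v → mate-mate v (paired? v) }

theorem5 : (G : Graph) → Partial2Tree G → (∀ v → degree G v ≤ 4) →
    (m : ℕ) → (S : Fin m → Fin 2 → Fin (n G)) →
    (∀ i → S i zero ≢ S i (suc zero)) →
    (∀ i a → degree G (S i a) ≡ 2) →
    (∀ i j a b → S i a ≡ S j b → i ≡ j) →
    Σ (EdgeColoring G) λ c → Is2LinearColoring G c ×
    (∀ i → ¬ (Monochromatic G c (S i zero) × Monochromatic G c (S i (suc zero))))
theorem5 G D Δ≤4 m S distinct _ disjoint with
  Reduction.solvable G (λ v → countTrue≤⇒atMost 4 (adj G v) (Δ≤4 v)) (elimination G D)
    (n G) {λ _ → ⊤} (λ _ → yes tt) (atMost-N _) (Pairing.pairing S distinct disjoint)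
... | c , lin , separated = (c , λ u v _ → symmetric u v) , linear-forest , λ i (m₀ , m₁) →
    separated (S i zero) (λ eq → distinct i (trans (≡-sym eq) (mate-paired i zero (paired? _))))
      (monochromatic m₀ , subst (Mono (λ _ → ⊤) c) (≡-sym (mate-paired i zero (paired? _))) (monochromatic m₁))
  where
  open Reduction G (λ v → countTrue≤⇒atMost 4 (adj G v) (Δ≤4 v))
  open Linear lin
  open Pairing S distinct disjoint

  linear-forest : ∀ k → IsLinearForestColor G (c , λ u v _ → symmetric u v) k
  linear-forest k = noCore⇒acyclic
      (λ {u} {v} (uv , cuv) → adj-sym G uv , trans (symmetric v u) cuv)
      (λ X (nonempty , dense) → coreless k X (nonempty , λ x xX →
        atLeast-⊆ 2 (λ (yX , xy , cxy) → yX , edge tt tt xy , cxy) (dense x xX))) ,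
    λ v → atMost⇒countTrue≤ 2 _ (atMost-⊆ 2 (coloured v) (degree≤2 k v))
    where
    coloured : ∀ v {w} → adj G v w ∧ does (c v w ≟ᵇ k) ≡ true → Coloured (λ _ → ⊤) c k v w
    coloured v {w} eq with adj G v w in vw | c v w ≟ᵇ k
    coloured v eq | true | yes cvw = edge tt tt vw , cvw
    coloured v () | true | no _
    coloured v () | false | _

  monochromatic : ∀ {v} → Monochromatic G (c , λ u v _ → symmetric u v) v → Mono (λ _ → ⊤) c v
  monochromatic {v} (deg≡2 , same) = mono two (λ a b va vb → same a b (Edge.adjacent va) (Edge.adjacent vb))
    where
    two : AtLeast 2 (Edge (λ _ → ⊤) v)
    two with atLeast⊎atMost (λ x → edge? (λ _ → yes tt) v x) 1
    ... | inj₁ many = many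
    ... | inj₂ few with subst (_≤ 1) deg≡2
                (atMost⇒countTrue≤ 1 (adj G v) (atMost-⊆ 1 (λ vx → edge tt tt vx) few))
    ... | s≤s ()
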